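{- For any positive integer $k$, we have $N'_k(3) \leq N_k(3) \leq 11k-2$; in particular every tournament $T$ on $n \ge 11k-2$ vertices satisfies $\mathrm{sinv}'_k(T)\le \mathrm{sinv}_k(T) \leq 3$.
   Context: A tournament is an orientation of a complete graph. For a digraph $D$ and $X \subseteq V(D)$, inverting $X$ means reversing the direction of every arc of $D$ with both endvertices in $X$. A digraph $D$ is $k$-arc-strong if for every partition $(V_1,V_2)$ of $V(D)$ into nonempty sets there are at least $k$ arcs from $V_1$ to $V_2$; it is $k$-strong if $|V(D)|\ge k+1$ and $D-S$ is strongly connected for every $S\subseteq V(D)$ with $|S|<k$. $\mathrm{sinv}'_k(D)$ (resp. $\mathrm{sinv}_k(D)$) is the minimum number of sets whose successive inversion transforms $D$ into a $k$-arc-strong (resp. $k$-strong) digraph. For $n \ge 2k+1$, $m_k(n) = \max\{\mathrm{sinv}_k(T) : T \text{ tournament of order } n\}$ and $m'_k(n) = \max\{\mathrm{sinv}'_k(T) : T \text{ tournament of order } n\}$. For positive integers $k,i$, $N_k(i)$ (resp. $N'_k(i)$) is the smallest integer such that $m_k(n) \leq i$ (resp. $m'_k(n)\le i$) for all $n \geq N_k(i)$ (resp. $n\ge N'_k(i)$). -}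

module Defs where

open import Data.Bool using (Bool; false; not; _∧_; if_then_else_; T)
open import Data.Bool.Properties using (T?)
open import Data.Fin using (Fin)
open import Data.Fin.Subset using (Subset; _∉_; ∁; ∣_∣; Nonempty)
open import Data.Fin.Subset.Properties using (_∈?_)
open import Data.List using (List; length; filter; foldl; allFin; cartesianProduct)
open import Data.Nat using (ℕ; _+_; _*_; _≤_; _<_)
open import Data.Product using (_×_; _,_; ∃-syntax)
open import Data.Vec using (lookup)
open import Relation.Binary.Construct.Closure.ReflexiveTransitive using (Star)
open import Relation.Binary.PropositionalEquality using (_≡_; _≢_)
open import Relation.Nullary.Decidable using (_×-dec_)

-- D u v ≡ true means that D has an arc from u to v.
Digraph : ℕ → Set
Digraph n = Fin n → Fin n → Bool

record IsTournament {n : ℕ} (D : Digraph n) : Set where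
  field
    loopless : ∀ u → D u u ≡ false
    oriented : ∀ {u v} → u ≢ v → D u v ≡ not (D v u)

invert : ∀ {n} → Digraph n → Subset n → Digraph n
invert D X u v = if lookup X u ∧ lookup X v then D v u else D u v

invertAll : ∀ {n} → Digraph n → List (Subset n) → Digraph n
invertAll = foldl invert

arcsFromTo : ∀ {n} → Digraph n → Subset n → Subset n → List (Fin n × Fin n)
arcsFromTo {n} D A B =
  filter (λ (u , v) → u ∈? A ×-dec v ∈? B ×-dec T? (D u v))
         (cartesianProduct (allFin n) (allFin n))

ArcStrong : ℕ → ∀ {n} → Digraph n → Set
ArcStrong k {n} D =
  (V₁ : Subset n) → Nonempty V₁ → Nonempty (∁ V₁) →
  k ≤ length (arcsFromTo D V₁ (∁ V₁))

-- The arcs of D - S.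
ArcAvoiding : ∀ {n} → Digraph n → Subset n → Fin n → Fin n → Set
ArcAvoiding D S u v = u ∉ S × v ∉ S × T (D u v)

StronglyConnectedAvoiding : ∀ {n} → Digraph n → Subset n → Set
StronglyConnectedAvoiding D S =
  ∀ u v → u ∉ S → v ∉ S → Star (ArcAvoiding D S) u v

Strong : ℕ → ∀ {n} → Digraph n → Set
Strong k {n} D =
  k + 1 ≤ n × (∀ (S : Subset n) → ∣ S ∣ < k → StronglyConnectedAvoiding D S)

IsMin IsMax : (ℕ → Set) → ℕ → Set
IsMin P m = P m × (∀ j → P j → m ≤ j)
IsMax P m = P m × (∀ j → P j → j ≤ m)

-- Minima and maxima are given as relations, since they exist only under
-- hypotheses (for tournaments, n ≥ 2k+1): IsSinv k D s reads "sinv_k(D) exists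
-- and equals s", and similarly for m_k(n) and N_k(i) below.  The parameter Q is
-- Strong for the unprimed parameters and ArcStrong for the primed ones.
ConnectivityNotion : Set₁
ConnectivityNotion = ℕ → ∀ {n} → Digraph n → Set

IsInversionNumber : ConnectivityNotion → ℕ → ∀ {n} → Digraph n → ℕ → Set
IsInversionNumber Q k {n} D =
  IsMin λ s → ∃[ Xs ] (length {A = Subset n} Xs ≡ s × Q k (invertAll D Xs))

IsMaxInversionNumber : ConnectivityNotion → ℕ → ℕ → ℕ → Set
IsMaxInversionNumber Q k n =
  IsMax λ s → ∃[ D ] (IsTournament {n} D × IsInversionNumber Q k D s)

-- m_k(n) is only defined for n ≥ 2k+1, so the threshold ranges over N ≥ 2k+1.
IsThreshold : ConnectivityNotion → ℕ → ℕ → ℕ → Set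
IsThreshold Q k i =
  IsMin λ N → 2 * k + 1 ≤ N ×
    (∀ n → N ≤ n → ∃[ m ] (IsMaxInversionNumber Q k n m × m ≤ i))

IsSinv IsSinv′ : ℕ → ∀ {n} → Digraph n → ℕ → Set
IsSinv  = IsInversionNumber Strong
IsSinv′ = IsInversionNumber ArcStrong

IsN IsN′ : ℕ → ℕ → ℕ → Set
IsN  = IsThreshold Strong
IsN′ = IsThreshold ArcStrong

{-# OPTIONS --safe #-}
module Submission where

-- Two inversions are enough. Put c = 2k - 1. Choose disjoint sets A and B of c vertices such that
-- exchanging a vertex of either for another one does not increase the number of arcs that leave A or enter
-- B, and let M be the other vertices, of which there are at least 7k. By maximality, a vertex of A has at
-- least the outdegree of a vertex of M in the subtournament on A ∪ M, and a vertex of B at least its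
-- indegree on M ∪ B. The arcs between A and B can be switched row by row and column by column until each b
-- ∈ B has at least c/2, hence k, out-neighbours in A, and each a ∈ A at least k in-neighbours in B. If a
-- and b are switched according to bits α(a) and β(b), then inverting {a : α(a)} ∪ B and A ∪ {b : β(b)} does
-- this switching and affects no arc with an end in M.
--
-- Suppose that deleting S, |S| < k, then leaves a partition of the other vertices into nonempty P and Q
-- without arcs from P to Q. Comparing the average outdegrees in A ∪ M of Q ∩ M and of a subset X of A
-- gives, for X = A, that Q meets A if it meets M, and, for X = P ∩ A ≠ ∅, |Q ∩ M| + 3 |P ∩ A| ≤ 2c + 2 |S ∩
-- M| unless Q ∩ M = ∅. The same holds for the reversed tournament. If P meets B and Q meets A, then |P ∩ A|
-- ≥ k - |S ∩ A| and |Q ∩ B| ≥ k - |S ∩ B|, so |M| < 7k; otherwise P ⊆ A or Q ⊆ B, and again |M| < 7k.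
--
-- The extremal parameters exist because everything is finite and decidable. For the primed threshold to be
-- at most the other one it is used that m_k(n), being attained, yields a k-strong tournament of order n,
-- into which every tournament of order n can be inverted pair by pair.

open import Algebra.Properties.Semiring.Sum using ()
open import Data.Bool using (Bool; true; false; not; _∧_; _∨_; _xor_; if_then_else_; T)
open import Data.Bool.Properties using (∨-zeroʳ; ∨-comm; ∧-comm; ∧-assoc; ∧-zeroʳ; xor-comm; ¬-not; T?; T-≡) renaming (_≟_ to _≟ᵇ_)
open import Data.Empty using (⊥)
open import Data.Fin using (Fin; zero; suc; toℕ; _≟_)
open import Data.Fin.Properties using (any?; all?; toℕ-injective)
open import Data.Fin.Subset using (Subset; _∈_; _∉_; ∣_∣; ∁; ⁅_⁆; _∪_; ⊤) renaming (⊥ to ∅)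
open import Data.Fin.Subset.Properties using (_∈?_; x∈⁅x⁆; x∈⁅y⁆⇒x≡y; ∉⊥; x∈p∪q⁺; x∈p∪q⁻; ∣⁅x⁆∣≡1; ∣⊥∣≡0; ∣⊤∣≡n; p⊆q⇒∣p∣≤∣q∣; x∈∁p⇒x∉p; x∉p⇒x∈∁p; anySubset?; nonempty?)
open import Data.List using (List; []; _∷_; length; allFin; cartesianProduct)
open import Data.List.Membership.Propositional using () renaming (_∈_ to _∈ˡ_)
open import Data.List.Membership.Propositional.Properties using (∈-filter⁺; ∈-filter⁻; ∈-cartesianProduct⁺; ∈-allFin)
open import Data.List.Properties using (filter-≐)
open import Data.List.Relation.Unary.Any using (here; there)
open import Data.Nat using (ℕ; zero; suc; _+_; _*_; _∸_; _≤_; _<_; z≤n; s≤s; _≤?_; _<?_; >-nonZero)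
open import Data.Nat.Properties hiding (_≟_)
open import Data.Nat.Tactic.RingSolver using (solve-∀)
open import Data.Product using (_×_; _,_; ∃-syntax; proj₁; proj₂; map₂)
open import Data.Sum using (_⊎_; inj₁; inj₂)
open import Data.Vec using (Vec; []; _∷_; lookup; tabulate)
open import Data.Vec.Functional using (updateAt)
open import Data.Vec.Functional.Properties using (updateAt-updates; updateAt-minimal)
open import Data.Vec.Properties using (lookup∘tabulate; []=⇒lookup; lookup⇒[]=)
open import Function using (_∘_; const; flip; Equivalence)
open import Relation.Binary.Construct.Closure.ReflexiveTransitive as Star using (Star; ε; _◅_; _◅◅_)
open import Relation.Binary.Definitions using (tri<; tri≈; tri>) renaming (Decidable to Decidable₂)
open import Relation.Binary.PropositionalEquality
open import Relation.Nullary using (¬_; Dec; yes; no; contradiction)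
open import Relation.Nullary.Decidable using (_×-dec_; _→-dec_; ¬?; map′; does; decidable-stable; dec-true; dec-false)
open import Relation.Unary using (Decidable)
open import Defs

open Algebra.Properties.Semiring.Sum +-*-semiring using (sum; ∑-comm; ∑-distrib-+; sum-cong-≗; *-distribˡ-sum; *-distribʳ-sum; sum-replicate-zero)

private variable
  n k : ℕ

-- Finite sums and counting in tournaments

sum-mono : {f g : Fin n → ℕ} → (∀ i → f i ≤ g i) → sum f ≤ sum g
sum-mono {zero}  f≤g = z≤n
sum-mono {suc n} f≤g = +-mono-≤ (f≤g zero) (sum-mono (f≤g ∘ suc))

sum-≤-n* : {f : Fin n → ℕ} (b : ℕ) → (∀ i → f i ≤ b) → sum f ≤ n * b
sum-≤-n* {zero}  b f≤b = z≤n
sum-≤-n* {suc n} b f≤b = +-mono-≤ (f≤b zero) (sum-≤-n* b (f≤b ∘ suc))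

sum-zero : {f : Fin n → ℕ} → (∀ u → f u ≡ 0) → sum f ≡ 0
sum-zero {n} f≡0 = trans (sum-cong-≗ f≡0) (sum-replicate-zero n)

∑∑-distrib-+ : (f g : Fin n → Fin n → ℕ) →
  (sum λ u → sum λ v → f u v + g u v) ≡ (sum λ u → sum λ v → f u v) + (sum λ u → sum λ v → g u v)
∑∑-distrib-+ f g = trans (sum-cong-≗ λ u → ∑-distrib-+ (f u) (g u)) (∑-distrib-+ (sum ∘ f) (sum ∘ g))

*-sum-sum : ∀ {m n} (f : Fin m → ℕ) (g : Fin n → ℕ) → sum f * sum g ≡ sum λ i → sum λ j → f i * g j
*-sum-sum f g = trans (*-distribʳ-sum (sum g) f) (sum-cong-≗ λ i → *-distribˡ-sum (f i) g)

-- The replaced term is added back on the opposite side, so no truncated subtraction occurs. Each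
-- improvement step of the local searches below is measured with it.
sum-updateAt : ∀ {A : Set} (h : Fin n → A → ℕ) (a : Fin n → A) i (f : A → A) →
  sum (λ j → h j (updateAt a i f j)) + h i (a i) ≡ sum (λ j → h j (a j)) + h i (f (a i))
sum-updateAt h a zero    f = swap (h zero (f (a zero))) _ _
  where
  swap : ∀ x s y → x + s + y ≡ y + s + x
  swap = solve-∀
sum-updateAt h a (suc i) f = begin
  h zero (a zero) + t + y       ≡⟨ +-assoc (h zero (a zero)) t y ⟩
  h zero (a zero) + (t + y)     ≡⟨ cong (h zero (a zero) +_) (sum-updateAt (h ∘ suc) (a ∘ suc) i f) ⟩
  h zero (a zero) + (s + z)     ≡⟨ +-assoc (h zero (a zero)) s z ⟨
  h zero (a zero) + s + z       ∎
  where
  open ≡-Reasoning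
  t = sum (λ j → h (suc j) (updateAt (a ∘ suc) i f j))
  s = sum (λ j → h (suc j) (a (suc j)))
  y = h (suc i) (a (suc i))
  z = h (suc i) (f (a (suc i)))

𝟙 : Bool → ℕ
𝟙 true  = 1
𝟙 false = 0

∧-trueˡ : ∀ {a b} → a ∧ b ≡ true → a ≡ true
∧-trueˡ {true} _ = refl

∧-trueʳ : ∀ {a b} → a ∧ b ≡ true → b ≡ true
∧-trueʳ {true} b≡true = b≡true

𝟙≤1 : ∀ b → 𝟙 b ≤ 1
𝟙≤1 true  = ≤-refl
𝟙≤1 false = z≤n

VertexSet : ℕ → Set
VertexSet n = Fin n → Bool

infixr 6 _∩_
_∩_ : VertexSet n → VertexSet n → VertexSet n
(X ∩ Y) u = X u ∧ Y u

# : VertexSet n → ℕ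
# X = sum (𝟙 ∘ X)

#-member : {X : VertexSet n} → 0 < # X → ∃[ u ] X u ≡ true
#-member {suc n} {X} 0<X with X zero in eq
... | true  = zero , eq
... | false with #-member {X = X ∘ suc} 0<X
...   | u , u∈X = suc u , u∈X

#-positive : {X : VertexSet n} {u : Fin n} → X u ≡ true → 0 < # X
#-positive {X = X} {zero}  u∈X rewrite u∈X = s≤s z≤n
#-positive {X = X} {suc u} u∈X = ≤-trans (#-positive {X = X ∘ suc} {u} u∈X) (m≤n+m _ (𝟙 (X zero)))

#-empty : {X : VertexSet n} → (∀ u → X u ≡ false) → # X ≡ 0
#-empty empty = sum-zero λ u → cong 𝟙 (empty u)

#⊤ : ∀ n → # {n} (const true) ≡ n
#⊤ zero    = refl
#⊤ (suc n) = cong suc (#⊤ n)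

-- Partitions into three parts are encoded by indicators that sum to 1 at every vertex, which makes
-- splitting a count a termwise matter.
#-split : (X Y₁ Y₂ Y₃ : VertexSet n) → (∀ u → 𝟙 (Y₁ u) + 𝟙 (Y₂ u) + 𝟙 (Y₃ u) ≡ 1) →
  # (Y₁ ∩ X) + # (Y₂ ∩ X) + # (Y₃ ∩ X) ≡ # X
#-split X Y₁ Y₂ Y₃ partition = sym (begin
  # X                                         ≡⟨ sum-cong-≗ (λ u → split (X u) (Y₁ u) (Y₂ u) (Y₃ u) (partition u)) ⟩
  sum (λ u → 𝟙 ((Y₁ ∩ X) u) + 𝟙 ((Y₂ ∩ X) u) + 𝟙 ((Y₃ ∩ X) u))
    ≡⟨ ∑-distrib-+ (λ u → 𝟙 ((Y₁ ∩ X) u) + 𝟙 ((Y₂ ∩ X) u)) _ ⟩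
  sum (λ u → 𝟙 ((Y₁ ∩ X) u) + 𝟙 ((Y₂ ∩ X) u)) + # (Y₃ ∩ X)
    ≡⟨ cong (_+ # (Y₃ ∩ X)) (∑-distrib-+ (𝟙 ∘ (Y₁ ∩ X)) _) ⟩
  # (Y₁ ∩ X) + # (Y₂ ∩ X) + # (Y₃ ∩ X)        ∎)
  where
  open ≡-Reasoning
  split : ∀ x y₁ y₂ y₃ → 𝟙 y₁ + 𝟙 y₂ + 𝟙 y₃ ≡ 1 → 𝟙 x ≡ 𝟙 (y₁ ∧ x) + 𝟙 (y₂ ∧ x) + 𝟙 (y₃ ∧ x)
  split true  true  false false _ = refl
  split true  false true  false _ = refl
  split true  false false true  _ = refl
  split false true  false false _ = refl
  split false false true  false _ = refl
  split false false false true  _ = refl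

subset-of-size : ∀ c (X : VertexSet n) → c ≤ # X →
  ∃[ Y ] (# {n} Y ≡ c × (∀ u → Y u ≡ true → X u ≡ true))
subset-of-size {n} zero X _ = (λ _ → false) , #-empty {n} (λ _ → refl) , λ _ ()
subset-of-size {suc n} (suc c) X c≤X with X zero in eq
... | true with subset-of-size c (X ∘ suc) (≤-pred c≤X)
...   | Y , Y≡c , Y⊆X = (λ { zero → true ; (suc u) → Y u }) , cong suc Y≡c , λ { zero _ → eq ; (suc u) → Y⊆X u }
subset-of-size {suc n} (suc c) X c≤X | false with subset-of-size (suc c) (X ∘ suc) c≤X
...   | Y , Y≡c , Y⊆X = (λ { zero → false ; (suc u) → Y u }) , Y≡c , λ { zero () ; (suc u) → Y⊆X u }

arcs : Digraph n → VertexSet n → VertexSet n → ℕ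
arcs D X Y = sum λ u → sum λ v → 𝟙 (X u ∧ Y v ∧ D u v)

outdegree : Digraph n → VertexSet n → Fin n → ℕ
outdegree D W u = sum λ v → 𝟙 (W v ∧ D u v)

arcs-outdegree : (D : Digraph n) (X W : VertexSet n) → arcs D X W ≡ sum λ u → 𝟙 (X u) * outdegree D W u
arcs-outdegree {n} D X W = sum-cong-≗ λ u → row (X u)
  where
  row : ∀ {u} b → sum (λ v → 𝟙 (b ∧ W v ∧ D u v)) ≡ 𝟙 b * outdegree D W u
  row true  = sym (*-identityˡ _)
  row false = sum-zero {n} {λ v → 0} λ _ → refl

#*# : ∀ (X Y : VertexSet n) → # X * # Y ≡ sum λ u → sum λ v → 𝟙 (X u ∧ Y v)
#*# X Y = trans (*-sum-sum (𝟙 ∘ X) (𝟙 ∘ Y)) (sum-cong-≗ λ u → sum-cong-≗ λ v → prod (X u) (Y v))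
  where
  prod : ∀ x y → 𝟙 x * 𝟙 y ≡ 𝟙 (x ∧ y)
  prod true  true  = refl
  prod true  false = refl
  prod false y     = refl

-- This compares the average outdegrees of `X` and `Y`, multiplied out to avoid division: the
-- inequality for the pair (x, y) is summed over `X` × `Y`.
arcs-averaging : (D : Digraph n) (X Y W : VertexSet n) →
  (∀ x y → X x ≡ true → Y y ≡ true → outdegree D W y ≤ outdegree D W x) →
  # X * arcs D Y W ≤ # Y * arcs D X W
arcs-averaging D X Y W dominates = begin
  # X * arcs D Y W                            ≡⟨ cong (# X *_) (arcs-outdegree D Y W) ⟩
  # X * sum (λ y → 𝟙 (Y y) * d y)             ≡⟨ *-sum-sum (𝟙 ∘ X) (λ y → 𝟙 (Y y) * d y) ⟩
  (sum λ x → sum λ y → 𝟙 (X x) * (𝟙 (Y y) * d y))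
    ≤⟨ sum-mono (λ x → sum-mono λ y → cell x y) ⟩
  (sum λ x → sum λ y → 𝟙 (Y y) * (𝟙 (X x) * d x)) ≡⟨ ∑-comm (λ x y → 𝟙 (Y y) * (𝟙 (X x) * d x)) ⟩
  (sum λ y → sum λ x → 𝟙 (Y y) * (𝟙 (X x) * d x)) ≡⟨ *-sum-sum (𝟙 ∘ Y) (λ x → 𝟙 (X x) * d x) ⟨
  # Y * sum (λ x → 𝟙 (X x) * d x)             ≡⟨ cong (# Y *_) (arcs-outdegree D X W) ⟨
  # Y * arcs D X W                            ∎
  where
  open ≤-Reasoning
  d = outdegree D W
  cell : ∀ x y → 𝟙 (X x) * (𝟙 (Y y) * d y) ≤ 𝟙 (Y y) * (𝟙 (X x) * d x)
  cell x y with X x in x∈X | Y y in y∈Y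
  ... | true  | true  = *-monoʳ-≤ 1 (*-monoʳ-≤ 1 (dominates x y x∈X y∈Y))
  ... | true  | false = z≤n
  ... | false | true  = z≤n
  ... | false | false = z≤n

δ : Fin n → Fin n → ℕ
δ zero    zero    = 1
δ zero    (suc v) = 0
δ (suc u) zero    = 0
δ (suc u) (suc v) = δ u v

δ-refl : (u : Fin n) → δ u u ≡ 1
δ-refl zero    = refl
δ-refl (suc u) = δ-refl u

δ-≢ : {u v : Fin n} → u ≢ v → δ u v ≡ 0
δ-≢ {u = zero}  {zero}  u≢v = contradiction refl u≢v
δ-≢ {u = zero}  {suc v} u≢v = refl
δ-≢ {u = suc u} {zero}  u≢v = refl
δ-≢ {u = suc u} {suc v} u≢v = δ-≢ (u≢v ∘ cong suc)

sum-δ : (f : Fin n → ℕ) (u : Fin n) → sum (λ v → δ u v * f v) ≡ f u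
sum-δ {suc n} f zero    = trans (cong₂ _+_ (*-identityˡ (f zero))
  (sum-zero {f = λ v → δ {suc n} zero (suc v) * f (suc v)} λ _ → refl)) (+-identityʳ _)
sum-δ f (suc u) = sum-δ (f ∘ suc) u

-- Each ordered pair from `X` is an arc, a reversed arc or a diagonal pair; `δ` counts the last
-- kind.
arcs-within : {D : Digraph n} → IsTournament D → (X : VertexSet n) →
  2 * arcs D X X + # X ≡ # X * # X
arcs-within {n} {D} t X = begin
  2 * arcs D X X + # X
    ≡⟨ cong (λ e → arcs D X X + e + # X) (trans (+-identityʳ _) (∑-comm (λ u v → 𝟙 (X u ∧ X v ∧ D u v)))) ⟩
  arcs D X X + (sum λ u → sum λ v → 𝟙 (X v ∧ X u ∧ D v u)) + # X
    ≡⟨ cong₂ _+_ (sym (∑∑-distrib-+ forward backward)) (sum-cong-≗ λ u → sym (sum-δ (𝟙 ∘ X) u)) ⟩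
  (sum λ u → sum λ v → 𝟙 (X u ∧ X v ∧ D u v) + 𝟙 (X v ∧ X u ∧ D v u)) + (sum λ u → sum λ v → δ u v * 𝟙 (X v))
    ≡⟨ ∑∑-distrib-+ (λ u v → forward u v + backward u v) (λ u v → δ u v * 𝟙 (X v)) ⟨
  (sum λ u → sum λ v → 𝟙 (X u ∧ X v ∧ D u v) + 𝟙 (X v ∧ X u ∧ D v u) + δ u v * 𝟙 (X v))
    ≡⟨ (sum-cong-≗ λ u → sum-cong-≗ λ v → cell u v) ⟩
  (sum λ u → sum λ v → 𝟙 (X u ∧ X v)) ≡⟨ #*# X X ⟨
  # X * # X ∎
  where
  open ≡-Reasoning
  open IsTournament t
  forward backward : Fin n → Fin n → ℕ
  forward  u v = 𝟙 (X u ∧ X v ∧ D u v)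
  backward u v = 𝟙 (X v ∧ X u ∧ D v u)
  bits : ∀ x y d → 𝟙 (x ∧ y ∧ not d) + 𝟙 (y ∧ x ∧ d) + 0 ≡ 𝟙 (x ∧ y)
  bits true true true = refl
  bits true true false = refl
  bits true false d = refl
  bits false true d = refl
  bits false false d = refl
  diagonal : ∀ x → 𝟙 (x ∧ x ∧ false) + 𝟙 (x ∧ x ∧ false) + 1 * 𝟙 x ≡ 𝟙 (x ∧ x)
  diagonal true  = refl
  diagonal false = refl
  cell : ∀ u v → 𝟙 (X u ∧ X v ∧ D u v) + 𝟙 (X v ∧ X u ∧ D v u) + δ u v * 𝟙 (X v) ≡ 𝟙 (X u ∧ X v)
  cell u v with u ≟ v
  ... | yes refl rewrite loopless u | δ-refl u = diagonal (X u)
  ... | no  u≢v rewrite oriented u≢v | δ-≢ u≢v = bits (X u) (X v) (D v u)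

-- Averaging across a separation

-- Used for A, P, Q and, in the reversed tournament, for B, Q, P. `D` is the tournament before the
-- inversions, so arcs from `P` to `Q` are excluded only for pairs that meet `M`, where the
-- inversions change nothing.
module InitialPart {n} {D : Digraph n} (tournament : IsTournament D) (A M P Q S : VertexSet n)
  (disjoint  : ∀ u → M u ≡ true → A u ≡ false)
  (partition : ∀ u → 𝟙 (P u) + 𝟙 (Q u) + 𝟙 (S u) ≡ 1)
  (maximal   : ∀ a x → A a ≡ true → M x ≡ true →
               outdegree D (λ u → A u ∨ M u) x ≤ outdegree D (λ u → A u ∨ M u) a)
  (no-arc    : ∀ u v → P u ≡ true → Q v ≡ true → M u ∨ M v ≡ true → D u v ≡ false)
  where

  open IsTournament tournament

  W : VertexSet n
  W u = A u ∨ M u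

  q : ℕ
  q = # (Q ∩ M)

  Q-arc-P : ∀ u v → Q u ≡ true → M u ≡ true → P v ≡ true → D u v ≡ true
  Q-arc-P u v u∈Q u∈M v∈P with u ≟ v
  ... | yes refl with () ← subst₂ (λ p q → 𝟙 p + 𝟙 q + 𝟙 (S u) ≡ 1) v∈P u∈Q (partition u)
  ... | no u≢v rewrite oriented u≢v | no-arc v u v∈P u∈Q (trans (cong (M v ∨_) u∈M) (∨-zeroʳ (M v))) = refl

  #W : # W ≡ # A + # M
  #W = trans (sum-cong-≗ λ u → bits (A u) (M u) (disjoint u)) (∑-distrib-+ (𝟙 ∘ A) (𝟙 ∘ M))
    where
    bits : ∀ a m → (m ≡ true → a ≡ false) → 𝟙 (a ∨ m) ≡ 𝟙 a + 𝟙 m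
    bits true  true  h with () ← h refl
    bits true  false h = refl
    bits false m     h = refl

  -- Every vertex of X has at least the outdegree in W of every vertex of Q ∩ M,
  -- so the same holds for the averages over X and over Q ∩ M.
  average-bound : (X : VertexSet n) → (∀ u → X u ≡ true → A u ≡ true) → 0 < q →
    # X * (q + 2 * # (P ∩ W)) + 2 * # X * (# X + q) ≤
    # X * # X + 2 * # X * # W + 2 * # (λ u → X u ∧ not (P u)) * q
  average-bound X X⊆A 0<q =
    *-cancelˡ-≤ q ⦃ >-nonZero 0<q ⦄ (arithmetic x q z r x′ (# W) (arcs D X X) (arcs D Y Y)
      (arcs D X W) (arcs D Y W) (arcs-within tournament X) (arcs-within tournament Y)
      (sym #R) lower upper (arcs-averaging D X Y W λ a y a∈X y∈Y → maximal a y (X⊆A a a∈X) (∧-trueʳ y∈Y)))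
    where
    Y R X′ : VertexSet n
    Y    = Q ∩ M
    R  u = W u ∧ not (X u) ∧ not (Y u)
    X′ u = X u ∧ not (P u)
    x z r x′ : ℕ
    x  = # X
    z  = # (P ∩ W)
    r  = # R
    x′ = # X′
    #R : # W ≡ r + (x + q)
    #R = trans (sum-cong-≗ λ u → bits (X u) (A u) (Q u) (M u) (X⊆A u) (disjoint u))
           (trans (∑-distrib-+ (𝟙 ∘ R) (λ u → 𝟙 (X u) + 𝟙 (Y u))) (cong (r +_) (∑-distrib-+ (𝟙 ∘ X) (𝟙 ∘ Y))))
      where
      bits : ∀ x a q m → (x ≡ true → a ≡ true) → (m ≡ true → a ≡ false) →
        𝟙 (a ∨ m) ≡ 𝟙 ((a ∨ m) ∧ not x ∧ not (q ∧ m)) + (𝟙 x + 𝟙 (q ∧ m))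
      bits x     true  q     true  _ h with () ← h refl
      bits true  true  true  false _ _ = refl
      bits true  true  false false _ _ = refl
      bits false true  true  false _ _ = refl
      bits false true  false false _ _ = refl
      bits true  false q     m     h _ with () ← h refl
      bits false false true  true  _ _ = refl
      bits false false false true  _ _ = refl
      bits false false true  false _ _ = refl
      bits false false false false _ _ = refl
    -- A vertex of `Y` has arcs to all of `P ∩ W`, because the opposite arcs are excluded.
    lower : arcs D Y Y + q * z ≤ arcs D Y W
    lower = begin
      arcs D Y Y + q * z ≡⟨ cong (arcs D Y Y +_) (#*# Y (P ∩ W)) ⟩
      arcs D Y Y + (sum λ u → sum λ v → 𝟙 (Y u ∧ (P ∩ W) v))
        ≡⟨ ∑∑-distrib-+ (λ u v → 𝟙 (Y u ∧ Y v ∧ D u v)) (λ u v → 𝟙 (Y u ∧ (P ∩ W) v)) ⟨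
      (sum λ u → sum λ v → 𝟙 (Y u ∧ Y v ∧ D u v) + 𝟙 (Y u ∧ (P ∩ W) v))
        ≤⟨ sum-mono (λ u → sum-mono λ v → bits (Q u) (M u) (A v) (P v) (Q v) (M v) (D u v) {S v} (Q-arc-P u v) (partition v)) ⟩
      arcs D Y W ∎
      where
      open ≤-Reasoning
      bits : ∀ qᵤ mᵤ a p q m d {s} → (qᵤ ≡ true → mᵤ ≡ true → p ≡ true → d ≡ true) → 𝟙 p + 𝟙 q + 𝟙 s ≡ 1 →
        𝟙 ((qᵤ ∧ mᵤ) ∧ (q ∧ m) ∧ d) + 𝟙 ((qᵤ ∧ mᵤ) ∧ p ∧ (a ∨ m)) ≤ 𝟙 ((qᵤ ∧ mᵤ) ∧ (a ∨ m) ∧ d)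
      bits false mᵤ    a     p q m d _ _ = z≤n
      bits true  false a     p q m d _ _ = z≤n
      bits true  true  a     true  true  m d _ ()
      bits true  true  true  true  false m d h _ rewrite h refl refl refl = ≤-refl
      bits true  true  false true  false m d h _ rewrite h refl refl refl with m
      ... | true  = ≤-refl
      ... | false = ≤-refl
      bits true  true  a     false false m d _ _ = z≤n
      bits true  true  true  false true  true  d _ _ = ≤-reflexive (+-identityʳ _)
      bits true  true  true  false true  false d _ _ = z≤n
      bits true  true  false false true  m d _ _ = ≤-reflexive (+-identityʳ _)
    -- The arcs from `X` into `W` end in `X`, in `R` or in `Y`. All pairs are allowed for `R`, while
    -- an arc into `Y` cannot start in `P`, which leaves `X′`.
    upper : arcs D X W ≤ arcs D X X + x * r + x′ * q
    upper = begin
      arcs D X W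
        ≤⟨ sum-mono (λ u → sum-mono λ v → bits (X u) (P u) (X v) (W v) (Q v) (M v) (D u v)
             λ u∈P v∈Q v∈M → no-arc u v u∈P v∈Q (trans (cong (M u ∨_) v∈M) (∨-zeroʳ (M u)))) ⟩
      (sum λ u → sum λ v → f u v + g u v + h u v)
        ≡⟨ ∑∑-distrib-+ (λ u v → f u v + g u v) h ⟩
      (sum λ u → sum λ v → f u v + g u v) + (sum λ u → sum λ v → h u v)
        ≡⟨ cong₂ _+_ (∑∑-distrib-+ f g) (sym (#*# X′ Y)) ⟩
      arcs D X X + (sum λ u → sum λ v → g u v) + x′ * q
        ≡⟨ cong (λ e → arcs D X X + e + x′ * q) (sym (#*# X R)) ⟩
      arcs D X X + x * r + x′ * q ∎
      where
      open ≤-Reasoning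
      f g h : Fin n → Fin n → ℕ
      f u v = 𝟙 (X u ∧ X v ∧ D u v)
      g u v = 𝟙 (X u ∧ R v)
      h u v = 𝟙 (X′ u ∧ Y v)
      bits : ∀ xᵤ pᵤ x w q m d → (pᵤ ≡ true → q ≡ true → m ≡ true → d ≡ false) →
        𝟙 (xᵤ ∧ w ∧ d) ≤ 𝟙 (xᵤ ∧ x ∧ d) + 𝟙 (xᵤ ∧ w ∧ not x ∧ not (q ∧ m)) + 𝟙 ((xᵤ ∧ not pᵤ) ∧ q ∧ m)
      bits false pᵤ    x     w     q     m     d     _ = z≤n
      bits true  pᵤ    x     false q     m     d     _ = z≤n
      bits true  pᵤ    x     true  q     m     false _ = z≤n
      bits true  pᵤ    true  true  q     m     true  _ = s≤s z≤n
      bits true  pᵤ    false true  false m     true  _ = s≤s z≤n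
      bits true  pᵤ    false true  true  false true  _ = s≤s z≤n
      bits true  false false true  true  true  true  _ = s≤s z≤n
      bits true  true  false true  true  true  true  h with () ← h refl refl refl
    -- The identities of `arcs-within` eliminate the arcs inside `X` and `Y`. A factor y = q then
    -- remains on both sides, and the caller cancels it.
    arithmetic : ∀ x y z r x′ w eX eY EX EY →
      2 * eX + x ≡ x * x → 2 * eY + y ≡ y * y → r + (x + y) ≡ w →
      eY + y * z ≤ EY → EX ≤ eX + x * r + x′ * y → x * EY ≤ y * EX →
      y * (x * (y + 2 * z) + 2 * x * (x + y)) ≤ y * (x * x + 2 * x * w + 2 * x′ * y)
    arithmetic x y z r x′ w eX eY EX EY eX≡ eY≡ refl lo up avg = begin
      y * (x * (y + 2 * z) + 2 * x * (x + y))                ≡⟨ eq₁ x y z ⟩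
      x * (y * y) + 2 * (x * (y * z)) + y * (2 * x * (x + y)) ≡⟨ cong (λ t → x * t + 2 * (x * (y * z)) + y * (2 * x * (x + y))) eY≡ ⟨
      x * (2 * eY + y) + 2 * (x * (y * z)) + y * (2 * x * (x + y)) ≡⟨ eq₂ x y z eY ⟩
      2 * (x * (eY + y * z)) + (x * y + y * (2 * x * (x + y)))
        ≤⟨ +-monoˡ-≤ (x * y + y * (2 * x * (x + y))) (*-monoʳ-≤ 2 (≤-trans (*-monoʳ-≤ x lo) (≤-trans avg (*-monoʳ-≤ y up)))) ⟩
      2 * (y * (eX + x * r + x′ * y)) + (x * y + y * (2 * x * (x + y))) ≡⟨ eq₃ x y r x′ eX ⟩
      y * ((2 * eX + x) + 2 * x * (r + (x + y)) + 2 * x′ * y) ≡⟨ cong (λ t → y * (t + 2 * x * (r + (x + y)) + 2 * x′ * y)) eX≡ ⟩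
      y * (x * x + 2 * x * (r + (x + y)) + 2 * x′ * y)        ∎
      where
      open ≤-Reasoning
      eq₁ : ∀ x y z → y * (x * (y + 2 * z) + 2 * x * (x + y)) ≡ x * (y * y) + 2 * (x * (y * z)) + y * (2 * x * (x + y))
      eq₁ = solve-∀
      eq₂ : ∀ x y z e → x * (2 * e + y) + 2 * (x * (y * z)) + y * (2 * x * (x + y))
        ≡ 2 * (x * (e + y * z)) + (x * y + y * (2 * x * (x + y)))
      eq₂ = solve-∀
      eq₃ : ∀ x y r x′ e → 2 * (y * (e + x * r + x′ * y)) + (x * y + y * (2 * x * (x + y)))
        ≡ y * ((2 * e + x) + 2 * x * (r + (x + y)) + 2 * x′ * y)
      eq₃ = solve-∀

  #P∩W : # (P ∩ W) ≡ # (P ∩ A) + # (P ∩ M)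
  #P∩W = trans (sum-cong-≗ λ u → bits (P u) (A u) (M u) (disjoint u)) (∑-distrib-+ (𝟙 ∘ (P ∩ A)) (𝟙 ∘ (P ∩ M)))
    where
    bits : ∀ p a m → (m ≡ true → a ≡ false) → 𝟙 (p ∧ (a ∨ m)) ≡ 𝟙 (p ∧ a) + 𝟙 (p ∧ m)
    bits true  true  true  h with () ← h refl
    bits true  true  false h = refl
    bits true  false m     h = refl
    bits false a     m     h = refl

  #M : # (P ∩ M) + q + # (S ∩ M) ≡ # M
  #M = #-split M P Q S partition

  -- Take `X = P ∩ A` in `average-bound`: no vertex of `X` lies outside `P`, so the last term
  -- vanishes, and the factor |P ∩ A| cancels.
  few-in-Q : 0 < q → 0 < # (P ∩ A) → q + 3 * # (P ∩ A) ≤ 2 * # A + 2 * # (S ∩ M)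
  few-in-Q 0<q 0<α =
    arithmetic _ q _ _ _ _ _ _ #P∩W #W #M 0<α
      (≤-trans (average-bound (P ∩ A) (λ u → ∧-trueʳ) 0<q)
        (≤-reflexive (cong (λ t → # (P ∩ A) * # (P ∩ A) + 2 * # (P ∩ A) * # W + 2 * t * q) outside-P)))
    where
    outside-P : # (λ u → (P ∩ A) u ∧ not (P u)) ≡ 0
    outside-P = #-empty λ u → bits (P u) (A u)
      where
      bits : ∀ p a → (p ∧ a) ∧ not p ≡ false
      bits true  true  = refl
      bits true  false = refl
      bits false a     = refl
    arithmetic : ∀ α q p z w a m s → z ≡ α + p → w ≡ a + m → p + q + s ≡ m → 0 < α →
      α * (q + 2 * z) + 2 * α * (α + q) ≤ α * α + 2 * α * w + 2 * 0 * q → q + 3 * α ≤ 2 * a + 2 * s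
    arithmetic α q p _ _ a _ s refl refl refl 0<α bound =
      +-cancelˡ-≤ (α + 2 * p + 2 * q) _ _ (*-cancelˡ-≤ α ⦃ >-nonZero 0<α ⦄
        (subst₂ _≤_ (eq₁ α q p) (eq₂ α q p a s) bound))
      where
      eq₁ : ∀ α q p → α * (q + 2 * (α + p)) + 2 * α * (α + q) ≡ α * (α + 2 * p + 2 * q + (q + 3 * α))
      eq₁ = solve-∀
      eq₂ : ∀ α q p a s → α * α + 2 * α * (a + (p + q + s)) + 2 * 0 * q ≡ α * (α + 2 * p + 2 * q + (2 * a + 2 * s))
      eq₂ = solve-∀

  -- Take `X = A` in `average-bound`. If `Q` missed `A`, only `S ∩ A` would lie outside `P`, and the
  -- bound would fail.
  meets-A : 2 * (# (S ∩ A) + # (S ∩ M)) < # A → 0 < q → 0 < # (Q ∩ A)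
  meets-A few 0<q with # (Q ∩ A) in Q∩A≡
  ... | suc _ = s≤s z≤n
  ... | zero  = contradiction bound (<⇒≱ (arithmetic (# A) q (# (P ∩ M)) (# (P ∩ A)) (# (P ∩ W)) (# (S ∩ A)) (# (S ∩ M)) _ _
                  #P∩W #W #M (trans (cong (_+ # (S ∩ A)) (trans (sym (+-identityʳ _)) (cong (# (P ∩ A) +_) (sym Q∩A≡)))) #A) few))
    where
    #A : # (P ∩ A) + # (Q ∩ A) + # (S ∩ A) ≡ # A
    #A = #-split A P Q S partition
    outside-P : # (λ u → A u ∧ not (P u)) ≡ # (S ∩ A)
    outside-P = sum-cong-≗ λ u → cong 𝟙 (bits (A u) (P u) (Q u) (S u) (partition u) (Q∩A-empty u))
      where
      Q∩A-empty : ∀ u → Q u ∧ A u ≢ true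
      Q∩A-empty u u∈Q∩A with () ← subst (0 <_) Q∩A≡ (#-positive {X = Q ∩ A} {u} u∈Q∩A)
      bits : ∀ a p q s → 𝟙 p + 𝟙 q + 𝟙 s ≡ 1 → q ∧ a ≢ true → a ∧ not p ≡ s ∧ a
      bits true  true  false false _ _ = refl
      bits true  false true  false _ h = contradiction refl h
      bits true  false false true  _ _ = refl
      bits false true  false false _ _ = refl
      bits false false true  false _ _ = refl
      bits false false false true  _ _ = refl
    bound : # A * (q + 2 * # (P ∩ W)) + 2 * # A * (# A + q) ≤ # A * # A + 2 * # A * # W + 2 * # (S ∩ A) * q
    bound = subst (λ t → # A * (q + 2 * # (P ∩ W)) + 2 * # A * (# A + q) ≤ # A * # A + 2 * # A * # W + 2 * t * q)
              outside-P (average-bound A (λ _ h → h) 0<q)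
    arithmetic : ∀ c q p α z s t w m → z ≡ α + p → w ≡ c + m → p + q + t ≡ m → α + s ≡ c → 2 * (s + t) < c →
      c * c + 2 * c * w + 2 * s * q < c * (q + 2 * z) + 2 * c * (c + q)
    -- With α = c - s the two sides differ by c(c - 2(s + t)) + q(c - 2s), which is positive. Adding
    -- 2cs to both sides avoids the subtraction.
    arithmetic c q p α _ s t _ _ refl refl refl α+s≡c few = +-cancelˡ-< (2 * (c * s)) _ _ (begin-strict
      2 * (c * s) + (c * c + 2 * c * (c + (p + q + t)) + 2 * s * q)
        ≡⟨ eq₁ c q p s t ⟩
      c * (2 * (s + t)) + (2 * s) * q + (3 * (c * c) + 2 * (c * p) + 2 * (c * q))
        <⟨ +-monoˡ-< _ (+-mono-<-≤ (*-monoʳ-< c ⦃ >-nonZero (≤-trans (s≤s z≤n) few) ⦄ few)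
             (*-monoˡ-≤ q (≤-trans (*-monoʳ-≤ 2 (m≤m+n s t)) (<⇒≤ few)))) ⟩
      c * c + c * q + (3 * (c * c) + 2 * (c * p) + 2 * (c * q))
        ≡⟨ eq₂ c q p ⟩
      2 * (c * c) + (c * q + 2 * (c * p) + 2 * c * (c + q))
        ≡⟨ cong (λ t → 2 * (c * t) + (c * q + 2 * (c * p) + 2 * c * (c + q))) (sym α+s≡c) ⟩
      2 * (c * (α + s)) + (c * q + 2 * (c * p) + 2 * c * (c + q))
        ≡⟨ eq₃ c q p α s ⟩
      2 * (c * s) + (c * (q + 2 * (α + p)) + 2 * c * (c + q)) ∎)
      where
      open ≤-Reasoning
      eq₁ : ∀ c q p s t → 2 * (c * s) + (c * c + 2 * c * (c + (p + q + t)) + 2 * s * q)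
        ≡ c * (2 * (s + t)) + (2 * s) * q + (3 * (c * c) + 2 * (c * p) + 2 * (c * q))
      eq₁ = solve-∀
      eq₂ : ∀ c q p → c * c + c * q + (3 * (c * c) + 2 * (c * p) + 2 * (c * q))
        ≡ 2 * (c * c) + (c * q + 2 * (c * p) + 2 * c * (c + q))
      eq₂ = solve-∀
      eq₃ : ∀ c q p α s → 2 * (c * (α + s)) + (c * q + 2 * (c * p) + 2 * c * (c + q))
        ≡ 2 * (c * s) + (c * (q + 2 * (α + p)) + 2 * c * (c + q))
      eq₃ = solve-∀

-- Impossibility of a small separation

reverse-tournament : {D : Digraph n} → IsTournament D → IsTournament (flip D)
reverse-tournament t = record
  { loopless = loopless
  ; oriented = λ u≢v → oriented (u≢v ∘ sym)
  }
  where open IsTournament t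

#-∩-comm : (X Y : VertexSet n) → # (X ∩ Y) ≡ # (Y ∩ X)
#-∩-comm X Y = sum-cong-≗ λ u → cong 𝟙 (∧-comm (X u) (Y u))

-- Applied to the out-neighbours of a vertex of P, which avoid Q, and with P and Q exchanged to the
-- in-neighbours of a vertex of Q.
#-cover : (P Q S A X : VertexSet n) → (∀ u → 𝟙 (P u) + 𝟙 (Q u) + 𝟙 (S u) ≡ 1) →
  (∀ u → Q u ≡ true → X u ≡ false) → # (A ∩ X) ≤ # (P ∩ A) + # (S ∩ A)
#-cover P Q S A X partition Q∩X=∅ = begin
  # (A ∩ X)                                     ≤⟨ sum-mono (λ u → bits (P u) (Q u) (S u) (A u) (X u) (partition u) (Q∩X=∅ u)) ⟩
  sum (λ u → 𝟙 ((P ∩ A) u) + 𝟙 ((S ∩ A) u))     ≡⟨ ∑-distrib-+ (𝟙 ∘ (P ∩ A)) (𝟙 ∘ (S ∩ A)) ⟩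
  # (P ∩ A) + # (S ∩ A)                         ∎
  where
  open ≤-Reasoning
  bits : ∀ p q s a x → 𝟙 p + 𝟙 q + 𝟙 s ≡ 1 → (q ≡ true → x ≡ false) → 𝟙 (a ∧ x) ≤ 𝟙 (p ∧ a) + 𝟙 (s ∧ a)
  bits p     q     s     false x _ _ = z≤n
  bits true  false s     true  x _ _ = ≤-trans (𝟙≤1 x) (s≤s z≤n)
  bits false true  s     true  x _ h rewrite h refl = z≤n
  bits false false true  true  x _ _ = 𝟙≤1 x

-- `D` is the tournament before the inversions and `D′` the digraph after them: the degree
-- conditions concern `D`, the arcs between `A` and `B` and the separation concern `D′`, and the two
-- agree on pairs that meet `M`.
module Separation {n k} {D D′ : Digraph n} (tournament : IsTournament D) (A M B P Q S : VertexSet n)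
  (zones : ∀ u → 𝟙 (A u) + 𝟙 (M u) + 𝟙 (B u) ≡ 1)
  (sides : ∀ u → 𝟙 (P u) + 𝟙 (Q u) + 𝟙 (S u) ≡ 1)
  (#A+1 : # A + 1 ≡ 2 * k)
  (#B+1 : # B + 1 ≡ 2 * k)
  (#S<k : # S < k)
  (7k≤#M : 7 * k ≤ # M)
  (A-maximal : ∀ a x → A a ≡ true → M x ≡ true →
    outdegree D (λ u → A u ∨ M u) x ≤ outdegree D (λ u → A u ∨ M u) a)
  (B-maximal : ∀ b x → B b ≡ true → M x ≡ true →
    outdegree (flip D) (λ u → B u ∨ M u) x ≤ outdegree (flip D) (λ u → B u ∨ M u) b)
  (same-at-M : ∀ u v → M u ∨ M v ≡ true → D′ u v ≡ D u v)
  (B-to-A    : ∀ b → B b ≡ true → k ≤ # (A ∩ D′ b))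
  (A-from-B  : ∀ a → A a ≡ true → k ≤ # (B ∩ flip D′ a))
  (no-arc    : ∀ u v → P u ≡ true → Q v ≡ true → D′ u v ≡ false)
  where

  private
    M-not-A : ∀ u → M u ≡ true → A u ≡ false
    M-not-A u u∈M with A u | M u | zones u
    M-not-A u u∈M | false | _    | _ = refl
    M-not-A u u∈M | true  | true | ()

    M-not-B : ∀ u → M u ≡ true → B u ≡ false
    M-not-B u u∈M with A u | M u | B u | zones u
    M-not-B u u∈M | _     | _    | false | _ = refl
    M-not-B u u∈M | true  | true | true  | ()
    M-not-B u u∈M | false | true | true  | ()

    sides′ : ∀ u → 𝟙 (Q u) + 𝟙 (P u) + 𝟙 (S u) ≡ 1
    sides′ u = trans (cong (_+ 𝟙 (S u)) (+-comm (𝟙 (Q u)) (𝟙 (P u)))) (sides u)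

    no-arc-D : ∀ u v → P u ≡ true → Q v ≡ true → M u ∨ M v ≡ true → D u v ≡ false
    no-arc-D u v u∈P v∈Q u∨v∈M = trans (sym (same-at-M u v u∨v∈M)) (no-arc u v u∈P v∈Q)

    no-arc-reversed : ∀ u v → Q u ≡ true → P v ≡ true → M u ∨ M v ≡ true → D v u ≡ false
    no-arc-reversed u v u∈Q v∈P u∨v∈M = no-arc-D v u v∈P u∈Q (trans (∨-comm (M v) (M u)) u∨v∈M)

    module Initial  = InitialPart tournament A M P Q S M-not-A sides A-maximal no-arc-D
    module Terminal = InitialPart (reverse-tournament tournament) B M Q P S M-not-B sides′ B-maximal no-arc-reversed

    p q α β σA σM σB : ℕ
    p = # (P ∩ M)
    q = # (Q ∩ M)
    α = # (P ∩ A)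
    β = # (Q ∩ B)
    σA = # (S ∩ A)
    σM = # (S ∩ M)
    σB = # (S ∩ B)

    #S : σA + σM + σB ≡ # S
    #S = trans (cong₂ _+_ (cong₂ _+_ (#-∩-comm S A) (#-∩-comm S M)) (#-∩-comm S B)) (#-split S A M B zones)

    -- As |S| ≤ k - 1, twice the size of a part of S is at most 2k - 2, one less than c = 2k - 1.
    few : ∀ c s t r → s + t + r ≡ # S → c + 1 ≡ 2 * k → 2 * (s + t) < c
    few c s t r s+t+r≡ c+1≡ = +-cancelʳ-< 1 (2 * (s + t)) c (begin-strict
      2 * (s + t) + 1        <⟨ ≤-reflexive (eq (s + t)) ⟩
      2 * suc (s + t)        ≤⟨ *-monoʳ-≤ 2 (≤-trans (s≤s (≤-trans (m≤m+n (s + t) r) (≤-reflexive s+t+r≡))) #S<k) ⟩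
      2 * k                  ≡⟨ c+1≡ ⟨
      c + 1                  ∎)
      where
      open ≤-Reasoning
      eq : ∀ x → suc (2 * x + 1) ≡ 2 * suc x
      eq = solve-∀

    P-meets-B : 0 < p → 0 < # (P ∩ B)
    P-meets-B = Terminal.meets-A (few (# B) σB σM σA (trans (rotate σA σM σB) #S) #B+1)
      where
      rotate : ∀ a m b → b + m + a ≡ a + m + b
      rotate = solve-∀

    Q-meets-A : 0 < q → 0 < # (Q ∩ A)
    Q-meets-A = Initial.meets-A (few (# A) σA σM σB #S #A+1)

    -- A vertex of `P ∩ B` has k out-neighbours in `A`, none of them in `Q`.
    P-A-large : 0 < # (P ∩ B) → k ≤ α + σA
    P-A-large 0<P∩B with b , b∈P∩B ← #-member {X = P ∩ B} 0<P∩B =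
      ≤-trans (B-to-A b (∧-trueʳ b∈P∩B))
        (#-cover P Q S A (D′ b) sides λ v v∈Q → no-arc b v (∧-trueˡ b∈P∩B) v∈Q)

    Q-B-large : 0 < # (Q ∩ A) → k ≤ β + σB
    Q-B-large 0<Q∩A with a , a∈Q∩A ← #-member {X = Q ∩ A} 0<Q∩A =
      ≤-trans (A-from-B a (∧-trueʳ a∈Q∩A))
        (#-cover Q P S B (flip D′ a) sides′ λ v v∈P → no-arc v a v∈P (∧-trueˡ a∈Q∩A))

    -- The summand 2 comes from 2c = 4k - 2. The case q = 0 stays separate because the averaging
    -- divides by q.
    bounded : ∀ q α c → c + 1 ≡ 2 * k → 0 < α → (0 < q → 0 < α → q + 3 * α ≤ 2 * c + 2 * σM) →
      q ≡ 0 ⊎ q + 3 * α + 2 ≤ 4 * k + 2 * σM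
    bounded zero _ _ _ _ _ = inj₁ refl
    bounded (suc q) α c c+1≡ 0<α bound = inj₂ (begin
      suc q + 3 * α + 2      ≤⟨ +-monoˡ-≤ 2 (bound (s≤s z≤n) 0<α) ⟩
      2 * c + 2 * σM + 2     ≡⟨ eq₁ c σM ⟩
      2 * (c + 1) + 2 * σM   ≡⟨ cong (λ t → 2 * t + 2 * σM) c+1≡ ⟩
      2 * (2 * k) + 2 * σM   ≡⟨ eq₂ k σM ⟩
      4 * k + 2 * σM         ∎)
      where
      open ≤-Reasoning
      eq₁ : ∀ c s → 2 * c + 2 * s + 2 ≡ 2 * (c + 1) + 2 * s
      eq₁ = solve-∀
      eq₂ : ∀ k s → 2 * (2 * k) + 2 * s ≡ 4 * k + 2 * s
      eq₂ = solve-∀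

    q-bounded : 0 < α → q ≡ 0 ⊎ q + 3 * α + 2 ≤ 4 * k + 2 * σM
    q-bounded 0<α = bounded q α (# A) #A+1 0<α Initial.few-in-Q

    p-bounded : 0 < β → p ≡ 0 ⊎ p + 3 * β + 2 ≤ 4 * k + 2 * σM
    p-bounded 0<β = bounded p β (# B) #B+1 0<β Terminal.few-in-Q

    σM<k : suc σM ≤ k
    σM<k = ≤-trans (s≤s (≤-trans (m≤n+m σM σA) (≤-trans (m≤m+n (σA + σM) σB) (≤-reflexive #S)))) #S<k

    -- If one side misses `M`, the other has at most 4k + 2σM vertices there, and 4k + 3σM < 7k
    -- since σM < k.
    one-sided : ∀ x y α → x ≡ 0 → 0 < α → y ≡ 0 ⊎ y + 3 * α + 2 ≤ 4 * k + 2 * σM → x + y + σM < 7 * k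
    one-sided _ _ _ refl _ (inj₁ refl) = ≤-trans σM<k (m≤m+n k (6 * k))
    one-sided _ y α refl 0<α (inj₂ bound) = begin-strict
      y + σM                   ≤⟨ +-monoˡ-≤ σM (≤-trans (m≤m+n y (3 * α)) (m≤m+n (y + 3 * α) 2)) ⟩
      y + 3 * α + 2 + σM       ≤⟨ +-monoˡ-≤ σM bound ⟩
      4 * k + 2 * σM + σM      ≡⟨ eq₁ k σM ⟩
      4 * k + 3 * σM           <⟨ +-monoʳ-< (4 * k) (*-monoʳ-< 3 σM<k) ⟩
      4 * k + 3 * k            ≡⟨ eq₂ k ⟩
      7 * k                    ∎
      where
      open ≤-Reasoning
      eq₁ : ∀ k s → 4 * k + 2 * s + s ≡ 4 * k + 3 * s
      eq₁ = solve-∀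
      eq₂ : ∀ k → 4 * k + 3 * k ≡ 7 * k
      eq₂ = solve-∀

    -- Substituting α ≥ k - σ into the bound on q + 3α leaves 4k - 3k = k.
    half : ∀ {q α σ} → k ≤ α + σ → q ≡ 0 ⊎ q + 3 * α + 2 ≤ 4 * k + 2 * σM → q ≤ k + 2 * σM + 3 * σ
    half _ (inj₁ refl) = z≤n
    half {q} {α} {σ} k≤ (inj₂ bound) = +-cancelʳ-≤ (3 * k) q _ (begin
      q + 3 * k                        ≤⟨ +-monoʳ-≤ q (*-monoʳ-≤ 3 k≤) ⟩
      q + 3 * (α + σ)                  ≡⟨ eq₁ q α σ ⟩
      q + 3 * α + 3 * σ                ≤⟨ +-monoˡ-≤ (3 * σ) (≤-trans (m≤m+n (q + 3 * α) 2) bound) ⟩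
      4 * k + 2 * σM + 3 * σ           ≡⟨ eq₂ k σM σ ⟩
      k + 2 * σM + 3 * σ + 3 * k       ∎)
      where
      open ≤-Reasoning
      eq₁ : ∀ q a s → q + 3 * (a + s) ≡ q + 3 * a + 3 * s
      eq₁ = solve-∀
      eq₂ : ∀ k s t → 4 * k + 2 * s + 3 * t ≡ k + 2 * s + 3 * t + 3 * k
      eq₂ = solve-∀

    -- Adding the two bounds gives 2k + 5σM + 3(σA + σB) ≤ 2k + 5|S| < 7k. Both α and β are positive
    -- because fewer than k vertices are deleted.
    two-sided : k ≤ α + σA → k ≤ β + σB → p + q + σM < 7 * k
    two-sided k≤α+σA k≤β+σB = begin-strict
      p + q + σM
        ≤⟨ +-monoˡ-≤ σM (+-mono-≤ (half {p} {β} {σB} k≤β+σB (p-bounded 0<β)) (half {q} {α} {σA} k≤α+σA (q-bounded 0<α))) ⟩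
      (k + 2 * σM + 3 * σB) + (k + 2 * σM + 3 * σA) + σM  ≤⟨ m≤m+n _ (2 * (σA + σB)) ⟩
      (k + 2 * σM + 3 * σB) + (k + 2 * σM + 3 * σA) + σM + 2 * (σA + σB) ≡⟨ eq₁ k σA σM σB ⟩
      2 * k + 5 * (σA + σM + σB)  ≡⟨ cong (λ t → 2 * k + 5 * t) #S ⟩
      2 * k + 5 * # S             <⟨ +-monoʳ-< (2 * k) (*-monoʳ-< 5 #S<k) ⟩
      2 * k + 5 * k               ≡⟨ eq₂ k ⟩
      7 * k                       ∎
      where
      open ≤-Reasoning
      positive : ∀ {x σ} → k ≤ x + σ → suc σ ≤ k → 0 < x
      positive {zero}  k≤σ σ<k = contradiction k≤σ (<⇒≱ σ<k)
      positive {suc x} _ _ = s≤s z≤n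
      0<α : 0 < α
      0<α = positive {α} {σA} k≤α+σA (≤-trans (s≤s (≤-trans (m≤m+n σA σM) (≤-trans (m≤m+n (σA + σM) σB) (≤-reflexive #S)))) #S<k)
      0<β : 0 < β
      0<β = positive {β} {σB} k≤β+σB (≤-trans (s≤s (≤-trans (m≤n+m σB (σA + σM)) (≤-reflexive #S))) #S<k)
      eq₁ : ∀ k a m b → (k + 2 * m + 3 * b) + (k + 2 * m + 3 * a) + m + 2 * (a + b) ≡ 2 * k + 5 * (a + m + b)
      eq₁ = solve-∀
      eq₂ : ∀ k → 2 * k + 5 * k ≡ 7 * k
      eq₂ = solve-∀

    zero-or-positive : ∀ x → x ≡ 0 ⊎ 0 < x
    zero-or-positive zero    = inj₁ refl
    zero-or-positive (suc x) = inj₂ (s≤s z≤n)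

    vanishes : ∀ x y → y ≡ 0 → (0 < x → 0 < y) → x ≡ 0
    vanishes zero    _ _    _ = refl
    vanishes (suc x) _ refl h with () ← h (s≤s z≤n)

    #P : # (P ∩ A) + # (P ∩ M) + # (P ∩ B) ≡ # P
    #P = trans (cong₂ _+_ (cong₂ _+_ (#-∩-comm P A) (#-∩-comm P M)) (#-∩-comm P B)) (#-split P A M B zones)

    #Q : # (Q ∩ A) + # (Q ∩ M) + # (Q ∩ B) ≡ # Q
    #Q = trans (cong₂ _+_ (cong₂ _+_ (#-∩-comm Q A) (#-∩-comm Q M)) (#-∩-comm Q B)) (#-split Q A M B zones)

    only-α : p ≡ 0 → # (P ∩ B) ≡ 0 → # P ≡ α
    only-α p≡0 P∩B≡0 = trans (sym #P) (trans (cong₂ (λ s t → α + s + t) p≡0 P∩B≡0) (trans (+-identityʳ _) (+-identityʳ α)))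

    only-β : q ≡ 0 → # (Q ∩ A) ≡ 0 → # Q ≡ β
    only-β q≡0 Q∩A≡0 = trans (sym #Q) (cong₂ (λ s t → s + t + β) Q∩A≡0 q≡0)

    M-small : 0 < # P → 0 < # Q → p + q + σM < 7 * k
    M-small 0<P 0<Q with zero-or-positive (# (P ∩ B)) | zero-or-positive (# (Q ∩ A))
    -- If `P` misses `B` it also misses `M`, so all of the nonempty set `P` lies in `A`. The next
    -- case is the mirror image.
    ... | inj₁ P∩B≡0 | _ = one-sided p q α p≡0 0<α (q-bounded 0<α)
      where
      p≡0 = vanishes p _ P∩B≡0 P-meets-B
      0<α = subst (0 <_) (only-α p≡0 P∩B≡0) 0<P
    ... | inj₂ _ | inj₁ Q∩A≡0 = subst (λ t → t + σM < 7 * k) (+-comm q p) (one-sided q p β q≡0 0<β (p-bounded 0<β))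
      where
      q≡0 = vanishes q _ Q∩A≡0 Q-meets-A
      0<β = subst (0 <_) (only-β q≡0 Q∩A≡0) 0<Q
    ... | inj₂ 0<P∩B | inj₂ 0<Q∩A = two-sided (P-A-large 0<P∩B) (Q-B-large 0<Q∩A)

  impossible : 0 < # P → 0 < # Q → ⊥
  impossible 0<P 0<Q = <⇒≱ (M-small 0<P 0<Q) (≤-trans 7k≤#M (≤-reflexive (sym Initial.#M)))

-- Local maxima

-- Every improvement raises `f` by at least 1, so the invariant bound ≤ f x + fuel survives when the
-- fuel drops by 1. With no fuel left, a further improvement would exceed the bound.
local-maximum : ∀ {X : Set} {Optimal : X → Set} (f : X → ℕ) (bound : ℕ) → (∀ x → f x ≤ bound) →
  (∀ x → Optimal x ⊎ (∃[ y ] f x < f y)) → X → ∃[ x ] Optimal x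
local-maximum {X} {Optimal} f bound f≤bound improve x₀ = search bound x₀ (m≤n+m bound (f x₀))
  where
  search : ∀ fuel x → bound ≤ f x + fuel → ∃[ x ] Optimal x
  search fuel x enough with improve x
  ... | inj₁ optimal = x , optimal
  search zero x enough | inj₂ (y , fx<fy) =
    contradiction (≤-trans enough (≤-reflexive (+-identityʳ (f x)))) (<⇒≱ (<-≤-trans fx<fy (f≤bound y)))
  search (suc fuel) x enough | inj₂ (y , fx<fy) =
    search fuel y (≤-trans enough (≤-trans (≤-reflexive (+-suc (f x) fuel)) (+-monoˡ-≤ fuel fx<fy)))

∑∑𝟙-bounded : (f : Fin n → Fin n → Bool) → (sum λ u → sum λ v → 𝟙 (f u v)) ≤ n * (n * 1)
∑∑𝟙-bounded {n} f = sum-≤-n* (n * 1) λ u → sum-≤-n* 1 λ v → 𝟙≤1 (f u v)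

<-transfer : ∀ {s s′ h h′} → s′ + h ≡ s + h′ → h < h′ → s < s′
<-transfer {s} {s′} {h} {h′} eq h<h′ = +-cancelʳ-< h s s′ (<-≤-trans (+-monoʳ-< s h<h′) (≤-reflexive (sym eq)))

-- `G` is a 0-1 matrix; `α` and `β` mark the rows and columns to be complemented.
switched : (Fin n → Fin n → Bool) → VertexSet n → VertexSet n → Fin n → Fin n → Bool
switched G α β a b = G a b xor (α a xor β b)

ones : (Fin n → Fin n → Bool) → VertexSet n → VertexSet n → VertexSet n → VertexSet n → ℕ
ones G A B α β = sum λ a → sum λ b → 𝟙 (A a ∧ B b ∧ switched G α β a b)

ones-transpose : (G : Fin n → Fin n → Bool) (A B α β : VertexSet n) → ones G A B α β ≡ ones (flip G) B A β α
ones-transpose G A B α β = trans (∑-comm (λ a b → 𝟙 (A a ∧ B b ∧ switched G α β a b)))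
  (sum-cong-≗ λ b → sum-cong-≗ λ a → cong 𝟙
    (trans (sym (∧-assoc (A a) (B b) _)) (trans (cong₂ _∧_ (∧-comm (A a) (B b)) (cong (G a b xor_) (xor-comm (α a) (β b))))
      (∧-assoc (B b) (A a) _))))

-- Complementing a row exchanges its ones and zeros within `B`, so a row with fewer ones than zeros
-- gains. Columns are treated as rows of the transpose.
improve-row : (G : Fin n → Fin n → Bool) (A B α β : VertexSet n) (a : Fin n) → A a ≡ true →
  2 * # (B ∩ switched G α β a) < # B → ones G A B α β < ones G A B (updateAt α a not) β
improve-row {n} G A B α β a a∈A minority = <-transfer (sum-updateAt h α a not) h<h′
  where
  h : Fin n → Bool → ℕ
  h a x = sum λ b → 𝟙 (A a ∧ B b ∧ (G a b xor (x xor β b)))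
  row : Bool → ℕ
  row x = # (B ∩ λ b → G a b xor (x xor β b))
  h-row : ∀ x → h a x ≡ row x
  h-row x = sum-cong-≗ λ b → cong (λ t → 𝟙 (t ∧ B b ∧ (G a b xor (x xor β b)))) a∈A
  rows : ∀ x → row x + row (not x) ≡ # B
  rows x = trans (sym (∑-distrib-+ (λ b → 𝟙 (B b ∧ (G a b xor (x xor β b)))) (λ b → 𝟙 (B b ∧ (G a b xor (not x xor β b))))))
    (sum-cong-≗ λ b → bits (B b) (G a b) x (β b))
    where
    bits : ∀ b g x y → 𝟙 (b ∧ (g xor (x xor y))) + 𝟙 (b ∧ (g xor (not x xor y))) ≡ 𝟙 b
    bits false g x y = refl
    bits true true  true  true  = refl
    bits true true  true  false = refl
    bits true true  false true  = refl
    bits true true  false false = refl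
    bits true false true  true  = refl
    bits true false true  false = refl
    bits true false false true  = refl
    bits true false false false = refl
  h<h′ : h a (α a) < h a (not (α a))
  h<h′ rewrite h-row (α a) | h-row (not (α a)) = +-cancelˡ-< (row (α a)) _ _
    (<-≤-trans (subst (_< # B) (cong (row (α a) +_) (+-identityʳ _)) minority) (≤-reflexive (sym (rows (α a)))))

switching : (G : Fin n → Fin n → Bool) (A B : VertexSet n) → ∃[ α ] ∃[ β ]
  ((∀ a → A a ≡ true → # B ≤ 2 * # (B ∩ switched G α β a)) ×
   (∀ b → B b ≡ true → # A ≤ 2 * # (A ∩ flip (switched G α β) b)))
switching {n} G A B with local-maximum (λ (α , β) → ones G A B α β) (n * (n * 1))
    (λ (α , β) → ∑∑𝟙-bounded (λ a b → A a ∧ B b ∧ switched G α β a b)) improve (const false , const false)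
  where
  column : ∀ α β b → # (A ∩ switched (flip G) β α b) ≡ # (A ∩ flip (switched G α β) b)
  column α β b = sum-cong-≗ λ a → cong (λ t → 𝟙 (A a ∧ (G a b xor t))) (xor-comm (β b) (α a))
  Balanced : VertexSet n × VertexSet n → Set
  Balanced (α , β) = (∀ a → A a ≡ true → # B ≤ 2 * # (B ∩ switched G α β a)) ×
                     (∀ b → B b ≡ true → # A ≤ 2 * # (A ∩ flip (switched G α β) b))
  improve : ∀ s → Balanced s ⊎ (∃[ s′ ] ones G A B (proj₁ s) (proj₂ s) < ones G A B (proj₁ s′) (proj₂ s′))
  improve (α , β)
    with any? (λ a → (A a ≟ᵇ true) ×-dec (2 * # (B ∩ switched G α β a) <? # B))
       | any? (λ b → (B b ≟ᵇ true) ×-dec (2 * # (A ∩ flip (switched G α β) b) <? # A))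
  ... | yes (a , a∈A , minority) | _ = inj₂ ((updateAt α a not , β) , improve-row G A B α β a a∈A minority)
  ... | no _ | yes (b , b∈B , minority) = inj₂ ((α , updateAt β b not) ,
    subst₂ _<_ (sym (ones-transpose G A B α β)) (sym (ones-transpose G A B α (updateAt β b not)))
      (improve-row (flip G) B A β α b b∈B (subst (λ t → 2 * t < # A) (sym (column α β b)) minority)))
  ... | no rows-balanced | no columns-balanced = inj₁
    ((λ a a∈A → ≮⇒≥ λ minority → rows-balanced (a , a∈A , minority)) ,
     (λ b b∈B → ≮⇒≥ λ minority → columns-balanced (b , b∈B , minority)))
... | (α , β) , balanced = α , β , balanced

-- Extremal choice of the two sets

exchange : VertexSet n → Fin n → Fin n → VertexSet n
exchange A a x = updateAt (updateAt A a (const false)) x (const true)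

exchange-member : (A : VertexSet n) (a x u : Fin n) → exchange A a x u ≡ true → u ≡ x ⊎ A u ≡ true
exchange-member A a x u u∈A′ with u ≟ x
... | yes u≡x = inj₁ u≡x
... | no  u≢x with u ≟ a
...   | no  u≢a = inj₂ (trans (sym (updateAt-minimal u a A u≢a)) (trans (sym (updateAt-minimal u x _ u≢x)) u∈A′))
...   | yes refl with () ← trans (sym (updateAt-updates u A)) (trans (sym (updateAt-minimal u x _ u≢x)) u∈A′)

sum-exchange : (h : Fin n → Bool → ℕ) (A : VertexSet n) (a x : Fin n) → A a ≡ true → A x ≡ false →
  sum (λ u → h u (exchange A a x u)) + (h x false + h a true) ≡ sum (λ u → h u (A u)) + (h x true + h a false)
sum-exchange h A a x a∈A x∉A = begin
  s″ + (h x false + h a true) ≡⟨ +-assoc s″ _ _ ⟨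
  s″ + h x false + h a true   ≡⟨ cong (_+ h a true) (subst (λ t → s″ + h x t ≡ s′ + h x true) A⁻x (sum-updateAt h A⁻ x (const true))) ⟩
  s′ + h x true + h a true    ≡⟨ swap s′ (h x true) (h a true) ⟩
  s′ + h a true + h x true    ≡⟨ cong (_+ h x true) (subst (λ t → s′ + h a t ≡ s + h a false) a∈A (sum-updateAt h A a (const false))) ⟩
  s + h a false + h x true    ≡⟨ trans (+-assoc s _ _) (cong (s +_) (+-comm (h a false) (h x true))) ⟩
  s + (h x true + h a false)  ∎
  where
  open ≡-Reasoning
  A⁻ = updateAt A a (const false)
  s = sum (λ u → h u (A u))
  s′ = sum (λ u → h u (A⁻ u))
  s″ = sum (λ u → h u (exchange A a x u))
  x≢a : x ≢ a
  x≢a refl with () ← trans (sym a∈A) x∉A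
  A⁻x : A⁻ x ≡ false
  A⁻x = trans (updateAt-minimal x a A x≢a) x∉A
  swap : ∀ s x y → s + x + y ≡ s + y + x
  swap = solve-∀

#-exchange : (A : VertexSet n) (a x : Fin n) → A a ≡ true → A x ≡ false → # (exchange A a x) ≡ # A
#-exchange A a x a∈A x∉A = +-cancelʳ-≡ 1 _ _ (sum-exchange (λ _ → 𝟙) A a x a∈A x∉A)

-- The potential to be maximised: the number of arcs that leave `A` or enter `B`, with an arc from
-- `A` to `B` counted once.
incident-arcs : Digraph n → VertexSet n → VertexSet n → ℕ
incident-arcs D A B = sum λ u → sum λ v → 𝟙 ((A u ∨ B v) ∧ D u v)

incident-arcs-reverse : (D : Digraph n) (A B : VertexSet n) → incident-arcs D A B ≡ incident-arcs (flip D) B A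
incident-arcs-reverse D A B = trans (∑-comm (λ u v → 𝟙 ((A u ∨ B v) ∧ D u v)))
  (sum-cong-≗ λ v → sum-cong-≗ λ u → cong (λ t → 𝟙 (t ∧ D u v)) (∨-comm (A u) (B v)))

-- Arcs into `B` are counted whatever their tail, so membership of a vertex in `A` contributes
-- exactly its outdegree into the complement of `B`.
exchange-improves : (D : Digraph n) (A B : VertexSet n) (a x : Fin n) → A a ≡ true → A x ≡ false →
  outdegree D (not ∘ B) a < outdegree D (not ∘ B) x → incident-arcs D A B < incident-arcs D (exchange A a x) B
exchange-improves {n} D A B a x a∈A x∉A d<d = <-transfer (sum-exchange h A a x a∈A x∉A)
  (subst₂ _<_ (cong (h x false +_) (sym (h-true a))) (cong (_+ h a false) (sym (h-true x)))
    (subst₂ _<_ (sym (shuffle (h x false) _ (h a false))) refl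
      (+-monoˡ-< (h a false) (+-monoʳ-< (h x false) d<d))))
  where
  h : Fin n → Bool → ℕ
  h u b = sum λ v → 𝟙 ((b ∨ B v) ∧ D u v)
  h-true : ∀ u → h u true ≡ h u false + outdegree D (not ∘ B) u
  h-true u = trans (sum-cong-≗ λ v → bits (B v) (D u v)) (∑-distrib-+ (λ v → 𝟙 (B v ∧ D u v)) (λ v → 𝟙 (not (B v) ∧ D u v)))
    where
    bits : ∀ b d → 𝟙 d ≡ 𝟙 (b ∧ d) + 𝟙 (not b ∧ d)
    bits true  d = sym (+-identityʳ _)
    bits false d = refl
  shuffle : ∀ p d q → p + (q + d) ≡ p + d + q
  shuffle = solve-∀

record Zones (n c : ℕ) : Set where
  field
    A B      : VertexSet n
    #A       : # A ≡ c
    #B       : # B ≡ c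
    disjoint : ∀ u → A u ≡ true → B u ≡ false

  M : VertexSet n
  M u = not (A u) ∧ not (B u)

initial-zones : ∀ {n c} → 2 * c ≤ n → Zones n c
initial-zones {n} {c} 2c≤n with subset-of-size c (const true) c≤n
  where
  c≤n : c ≤ # {n} (const true)
  c≤n = ≤-trans (m≤m+n c (c + 0)) (≤-trans 2c≤n (≤-reflexive (sym (#⊤ n))))
... | A , #A , _ with subset-of-size c (not ∘ A) c≤n∸c
  where
  bits : ∀ a → 𝟙 a + 𝟙 (not a) ≡ 1
  bits true  = refl
  bits false = refl
  #∁ : # A + # (not ∘ A) ≡ n
  #∁ = trans (sym (∑-distrib-+ (𝟙 ∘ A) (𝟙 ∘ not ∘ A))) (trans (sum-cong-≗ λ u → bits (A u)) (#⊤ n))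
  c≤n∸c : c ≤ # (not ∘ A)
  c≤n∸c = +-cancelˡ-≤ c c _ (≤-trans (≤-reflexive (cong (c +_) (sym (+-identityʳ c)))) (≤-trans 2c≤n
    (≤-reflexive (trans (sym #∁) (cong (_+ # (not ∘ A)) #A)))))
...   | B , #B , B⊆∁A = record { A = A ; B = B ; #A = #A ; #B = #B ; disjoint = disjoint }
  where
  disjoint : ∀ u → A u ≡ true → B u ≡ false
  disjoint u u∈A with B u in u∈B
  ... | false = refl
  ... | true with () ← trans (cong not (sym u∈A)) (B⊆∁A u u∈B)

record Extremal {n c} (D : Digraph n) (Z : Zones n c) : Set where
  open Zones Z
  field
    A-maximal : ∀ a x → A a ≡ true → M x ≡ true →
      outdegree D (λ u → A u ∨ M u) x ≤ outdegree D (λ u → A u ∨ M u) a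
    B-maximal : ∀ b x → B b ≡ true → M x ≡ true →
      outdegree (flip D) (λ u → B u ∨ M u) x ≤ outdegree (flip D) (λ u → B u ∨ M u) b

extremal-zones : ∀ {n c} (D : Digraph n) → 2 * c ≤ n → ∃[ Z ] Extremal {n} {c} D Z
extremal-zones {n} {c} D 2c≤n = local-maximum {Optimal = Extremal D}
  (λ Z → incident-arcs D (Zones.A Z) (Zones.B Z)) (n * (n * 1))
  (λ Z → ∑∑𝟙-bounded (λ u v → (Zones.A Z u ∨ Zones.B Z v) ∧ D u v)) improve (initial-zones 2c≤n)
  where
  improve : (Z : Zones n c) → Extremal D Z ⊎ (∃[ Z′ ]
    incident-arcs D (Zones.A Z) (Zones.B Z) < incident-arcs D (Zones.A Z′) (Zones.B {n} {c} Z′))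
  improve Z = result
    where
    open Zones Z
    disjoint′ : ∀ u → B u ≡ true → A u ≡ false
    disjoint′ u u∈B with A u in u∈A
    ... | false = refl
    ... | true with () ← trans (sym u∈B) (disjoint u u∈A)
    M⇒∉A : ∀ {x} → M x ≡ true → A x ≡ false
    M⇒∉A {x} x∈M with A x
    ... | false = refl
    M⇒∉B : ∀ {x} → M x ≡ true → B x ≡ false
    M⇒∉B {x} x∈M with A x | B x
    ... | false | false = refl
    -- The complement of `B` is `A ∪ M`, so an exchange that does not improve is exactly the
    -- inequality required by `Extremal`.
    A∨M : ∀ D u → outdegree D (λ v → A v ∨ M v) u ≡ outdegree D (not ∘ B) u
    A∨M D u = sum-cong-≗ λ v → cong (λ t → 𝟙 (t ∧ D u v)) (bits (A v) (B v) (disjoint v))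
      where
      bits : ∀ a b → (a ≡ true → b ≡ false) → a ∨ (not a ∧ not b) ≡ not b
      bits true  b h rewrite h refl = refl
      bits false b h = refl
    B∨M : ∀ D u → outdegree D (λ v → B v ∨ M v) u ≡ outdegree D (not ∘ A) u
    B∨M D u = sum-cong-≗ λ v → cong (λ t → 𝟙 (t ∧ D u v)) (bits (A v) (B v) (disjoint v))
      where
      bits : ∀ a b → (a ≡ true → b ≡ false) → b ∨ (not a ∧ not b) ≡ not a
      bits true  b     h rewrite h refl = refl
      bits false true  h = refl
      bits false false h = refl
    exchange-disjoint : ∀ (A B : VertexSet n) a x → (∀ u → A u ≡ true → B u ≡ false) → B x ≡ false →
      ∀ u → exchange A a x u ≡ true → B u ≡ false
    exchange-disjoint A B a x A∩B=∅ x∉B u u∈A′ with exchange-member A a x u u∈A′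
    ... | inj₁ refl = x∉B
    ... | inj₂ u∈A  = A∩B=∅ u u∈A
    result : Extremal D Z ⊎ (∃[ Z′ ] incident-arcs D A B < incident-arcs D (Zones.A Z′) (Zones.B {n} {c} Z′))
    result
      with any? (λ a → any? λ x → (A a ≟ᵇ true) ×-dec (M x ≟ᵇ true) ×-dec
             (outdegree D (not ∘ B) a <? outdegree D (not ∘ B) x))
         | any? (λ b → any? λ x → (B b ≟ᵇ true) ×-dec (M x ≟ᵇ true) ×-dec
             (outdegree (flip D) (not ∘ A) b <? outdegree (flip D) (not ∘ A) x))
    ... | yes (a , x , a∈A , x∈M , d<d) | _ = inj₂ (record
      { A = exchange A a x
      ; B = B
      ; #A = trans (#-exchange A a x a∈A (M⇒∉A x∈M)) #A
      ; #B = #B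
      ; disjoint = exchange-disjoint A B a x disjoint (M⇒∉B x∈M)
      } , exchange-improves D A B a x a∈A (M⇒∉A x∈M) d<d)
    ... | no _ | yes (b , x , b∈B , x∈M , d<d) = inj₂ (record
      { A = A
      ; B = exchange B b x
      ; #A = #A
      ; #B = trans (#-exchange B b x b∈B (M⇒∉B x∈M)) #B
      ; disjoint = disjoint″
      } , subst₂ _<_ (sym (incident-arcs-reverse D A B)) (sym (incident-arcs-reverse D A (exchange B b x)))
            (exchange-improves (flip D) B A b x b∈B (M⇒∉B x∈M) d<d))
      where
      disjoint″ : ∀ u → A u ≡ true → exchange B b x u ≡ false
      disjoint″ u u∈A with exchange B b x u in u∈B′
      ... | false = refl
      ... | true with () ← trans (sym u∈A) (exchange-disjoint B A b x disjoint′ (M⇒∉A x∈M) u u∈B′)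
    ... | no A-optimal | no B-optimal = inj₁ (record
      { A-maximal = λ a x a∈A x∈M → subst₂ _≤_ (sym (A∨M D x)) (sym (A∨M D a))
          (≮⇒≥ λ d<d → A-optimal (a , x , a∈A , x∈M , d<d))
      ; B-maximal = λ b x b∈B x∈M → subst₂ _≤_ (sym (B∨M (flip D) x)) (sym (B∨M (flip D) b))
          (≮⇒≥ λ d<d → B-optimal (b , x , b∈B , x∈M , d<d))
      })

-- Reachability, and the two inversions

record ReachableSet {n} (R : Fin n → Fin n → Set) (u : Fin n) : Set where
  field
    set       : VertexSet n
    source    : set u ≡ true
    reachable : ∀ v → set v ≡ true → Star R u v

-- Among the sets that contain `u` and only vertices reachable from it, one that cannot be enlarged
-- along an `R`-step is closed under `R`. It therefore decides reachability as well.
reachable-set : {R : Fin n → Fin n → Set} → Decidable₂ R → (u : Fin n) →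
  ∃[ P ] (∀ x y → ReachableSet.set {R = R} {u} P x ≡ true → R x y → ReachableSet.set P y ≡ true)
reachable-set {n} {R} R? u = local-maximum (# ∘ set) (n * 1) (λ P → sum-≤-n* 1 λ v → 𝟙≤1 (set P v)) improve start
  where
  open ReachableSet
  start : ReachableSet R u
  start = record
    { set       = updateAt (const false) u (const true)
    ; source    = updateAt-updates u (const false)
    ; reachable = only-u
    }
    where
    only-u : ∀ v → updateAt (const false) u (const true) v ≡ true → Star R u v
    only-u v v∈ with v ≟ u
    ... | yes refl = ε
    ... | no  v≢u with () ← trans (sym (updateAt-minimal v u (const false) v≢u)) v∈
  improve : (P : ReachableSet R u) → (∀ x y → set P x ≡ true → R x y → set P y ≡ true) ⊎ (∃[ P′ ] # (set P) < # (set P′))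
  improve P with any? (λ x → any? λ y → (set P x ≟ᵇ true) ×-dec (set P y ≟ᵇ false) ×-dec R? x y)
  ... | no closed = inj₁ λ x y x∈P xRy → step x y x∈P xRy
    where
    step : ∀ x y → set P x ≡ true → R x y → set P y ≡ true
    step x y x∈P xRy with set P y in y∈P
    ... | true  = refl
    ... | false = contradiction (x , y , x∈P , y∈P , xRy) closed
  ... | yes (x , y , x∈P , y∉P , xRy) = inj₂ (P′ , <-transfer (subst (λ t → # (set P′) + 𝟙 t ≡ # (set P) + 1) y∉P
          (sum-updateAt (λ _ → 𝟙) (set P) y (const true))) (s≤s z≤n))
    where
    grows : ∀ v → set P v ≡ true → updateAt (set P) y (const true) v ≡ true
    grows v v∈P with v ≟ y
    ... | yes refl = updateAt-updates y (set P)
    ... | no  v≢y  = trans (updateAt-minimal v y (set P) v≢y) v∈P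
    path : ∀ v → updateAt (set P) y (const true) v ≡ true → Star R u v
    path v v∈P′ with v ≟ y
    ... | yes refl = reachable P x x∈P ◅◅ (xRy ◅ ε)
    ... | no  v≢y  = reachable P v (trans (sym (updateAt-minimal v y (set P) v≢y)) v∈P′)
    P′ : ReachableSet R u
    P′ = record { set = updateAt (set P) y (const true) ; source = grows u (source P) ; reachable = path }

closed-under-Star : {R : Fin n → Fin n → Set} (P : VertexSet n) → (∀ x y → P x ≡ true → R x y → P y ≡ true) →
  ∀ {x y} → P x ≡ true → Star R x y → P y ≡ true
closed-under-Star P closed x∈P ε = x∈P
closed-under-Star P closed x∈P (xRy ◅ path) = closed-under-Star P closed (closed _ _ x∈P xRy) path

∉⇒lookup≡false : {S : Subset n} {u : Fin n} → u ∉ S → lookup S u ≡ false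
∉⇒lookup≡false {S = S} {u} u∉S with lookup S u in eq
... | true  = contradiction (lookup⇒[]= u S eq) u∉S
... | false = refl

∣∣≡# : (S : Subset n) → ∣ S ∣ ≡ # (lookup S)
∣∣≡# []          = refl
∣∣≡# (true ∷ S)  = cong suc (∣∣≡# S)
∣∣≡# (false ∷ S) = ∣∣≡# S

arc-avoiding? : (D : Digraph n) (S : Subset n) → Decidable₂ (ArcAvoiding D S)
arc-avoiding? D S u v = ¬? (u ∈? S) ×-dec ¬? (v ∈? S) ×-dec T? (D u v)

-- If v is not reachable from u in D - S, let `P` be the set reachable from u and `Q` the rest
-- outside S. `P` is closed, so no arc leads to `Q`, which contains v.
strong-if-no-separation : ∀ {k} {D : Digraph n} → k + 1 ≤ n →
  (∀ (P Q S : VertexSet n) → (∀ u → 𝟙 (P u) + 𝟙 (Q u) + 𝟙 (S u) ≡ 1) → # S < k →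
    (∀ u v → P u ≡ true → Q v ≡ true → D u v ≡ false) → 0 < # P → 0 < # Q → ⊥) →
  Strong k D
strong-if-no-separation {n} {k} {D} k+1≤n no-separation = k+1≤n , connected
  where
  connected : ∀ (S : Subset n) → ∣ S ∣ < k → StronglyConnectedAvoiding D S
  connected S ∣S∣<k u v u∉S v∉S with reachable-set (arc-avoiding? D S) u
  ... | R , closed with ReachableSet.set R v in v∈P
  ...   | true  = ReachableSet.reachable R v v∈P
  ...   | false = contradiction (#-positive {X = Q} v∈Q) (no-separation P Q (lookup S) sides
                    (subst (_< k) (∣∣≡# S) ∣S∣<k) no-arc (#-positive {X = P} source))
    where
    open ReachableSet R renaming (set to P)
    Q : VertexSet n
    Q x = not (P x) ∧ not (lookup S x)
    v∈Q : Q v ≡ true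
    v∈Q rewrite v∈P | ∉⇒lookup≡false v∉S = refl
    avoids : ∀ {x y} → x ∉ S → Star (ArcAvoiding D S) x y → y ∉ S
    avoids x∉S ε = x∉S
    avoids x∉S ((_ , y∉S , _) ◅ path) = avoids y∉S path
    sides : ∀ x → 𝟙 (P x) + 𝟙 (Q x) + 𝟙 (lookup S x) ≡ 1
    sides x with P x in x∈P | lookup S x in x∈S
    ... | true  | true  = contradiction (lookup⇒[]= x S x∈S) (avoids u∉S (reachable x x∈P))
    ... | true  | false = refl
    ... | false | true  = refl
    ... | false | false = refl
    no-arc : ∀ x y → P x ≡ true → Q y ≡ true → D x y ≡ false
    no-arc x y x∈P y∈Q with D x y in xy
    ... | false = refl
    ... | true  = contradiction (closed x y x∈P (avoids u∉S (reachable x x∈P) , y∉S , Equivalence.from T-≡ xy)) y∉P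
      where
      y∉P : P y ≢ true
      y∉P y∈P with () ← subst (λ t → not t ∧ not (lookup S y) ≡ true) y∈P y∈Q
      y∉S : y ∉ S
      y∉S y∈S with () ← trans (sym (∧-zeroʳ (not (P y)))) (subst (λ t → not (P y) ∧ not t ≡ true) ([]=⇒lookup y∈S) y∈Q)

module TwoInversions {n} (D : Digraph n) (tournament : IsTournament D) {c} (Z : Zones n c) (α β : VertexSet n) where
  open Zones Z
  open IsTournament tournament

  X Y : VertexSet n
  -- For a ∈ A and b ∈ B, both are in `X` exactly if α(a) holds and both are in `Y` exactly if β(b)
  -- holds, so the arc between them ends up reversed exactly if the two bits differ. `M` meets
  -- neither set.
  X u = (A u ∧ α u) ∨ B u
  Y u = A u ∨ (B u ∧ β u)

  sets : List (Subset n)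
  sets = tabulate X ∷ tabulate Y ∷ []

  inverted : ∀ u v → invertAll D sets u v ≡
    (if Y u ∧ Y v then (if X v ∧ X u then D u v else D v u) else (if X u ∧ X v then D v u else D u v))
  inverted u v rewrite lookup∘tabulate X u | lookup∘tabulate X v | lookup∘tabulate Y u | lookup∘tabulate Y v = refl

  same-at-M : ∀ u v → M u ∨ M v ≡ true → invertAll D sets u v ≡ D u v
  same-at-M u v u∨v∈M = trans (inverted u v) (bits (A u) (B u) (α u) (β u) (A v) (B v) (α v) (β v) u∨v∈M)
    where
    bits : ∀ {d d′ : Bool} a b x y a′ b′ x′ y′ → (not a ∧ not b) ∨ (not a′ ∧ not b′) ≡ true →
      (if (a ∨ (b ∧ y)) ∧ (a′ ∨ (b′ ∧ y′)) then (if ((a′ ∧ x′) ∨ b′) ∧ ((a ∧ x) ∨ b) then d else d′)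
       else (if ((a ∧ x) ∨ b) ∧ ((a′ ∧ x′) ∨ b′) then d′ else d)) ≡ d
    bits false false x y a′    b′    x′ y′ _ = refl
    bits true  b     x y false false x′ y′ _ rewrite ∧-zeroʳ (x ∨ b) = refl
    bits false true  x y false false x′ y′ _ rewrite ∧-zeroʳ y = refl
    bits true  b     x y true  b′    x′ y′ ()
    bits true  b     x y false true  x′ y′ ()
    bits false true  x y true  b′    x′ y′ ()
    bits false true  x y false true  x′ y′ ()

  -- The matrix is `flip D`: rows are indexed by `A`, and an entry 1 stands for an arc from b to a.
  from-B-to-A : ∀ a b → A a ≡ true → B b ≡ true → invertAll D sets b a ≡ switched (flip D) α β a b
  from-B-to-A a b a∈A b∈B = trans (inverted b a) formula
    where
    b∉A : A b ≡ false
    b∉A with A b in eq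
    ... | false = refl
    ... | true with () ← trans (sym b∈B) (disjoint b eq)
    a≢b : a ≢ b
    a≢b refl with () ← trans (sym a∈A) b∉A
    formula : (if Y b ∧ Y a then (if X a ∧ X b then D b a else D a b) else (if X b ∧ X a then D a b else D b a))
              ≡ D b a xor (α a xor β b)
    formula rewrite a∈A | b∈B | b∉A | disjoint a a∈A | oriented a≢b with α a | β b | D b a
    ... | true  | true  | true  = refl
    ... | true  | true  | false = refl
    ... | true  | false | true  = refl
    ... | true  | false | false = refl
    ... | false | true  | true  = refl
    ... | false | true  | false = refl
    ... | false | false | true  = refl
    ... | false | false | false = refl

module BalancedInversions {n k} (0<k : 0 < k) (11k≤2+n : 11 * k ≤ 2 + n) {D : Digraph n} (tournament : IsTournament D)
  {c} (c+1 : c + 1 ≡ 2 * k) (Z : Zones n c) (extremal : Extremal D Z) (α β : VertexSet n)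
  (rows    : ∀ a → Zones.A Z a ≡ true → # (Zones.B Z) ≤ 2 * # (Zones.B Z ∩ switched (flip D) α β a))
  (columns : ∀ b → Zones.B Z b ≡ true → # (Zones.A Z) ≤ 2 * # (Zones.A Z ∩ flip (switched (flip D) α β) b))
  where

  open Zones Z
  open Extremal extremal
  open TwoInversions D tournament Z α β
  zones : ∀ u → 𝟙 (A u) + 𝟙 (M u) + 𝟙 (B u) ≡ 1
  zones u with A u in u∈A | B u in u∈B
  ... | true  | true with () ← trans (sym u∈B) (disjoint u u∈A)
  ... | true  | false = refl
  ... | false | true  = refl
  ... | false | false = refl
  n≡ : n ≡ c + # M + c
  n≡ = trans (sym (#⊤ n)) (trans (sum-cong-≗ λ u → sym (zones u))
    (trans (∑-distrib-+ (λ u → 𝟙 (A u) + 𝟙 (M u)) (𝟙 ∘ B)) (trans (cong (_+ # B) (∑-distrib-+ (𝟙 ∘ A) (𝟙 ∘ M)))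
      (cong₂ (λ s t → s + # M + t) #A #B))))
  -- This is where 11k - 2 comes from: `A` and `B` together have 2c = 4k - 2 vertices.
  7k≤#M : 7 * k ≤ # M
  7k≤#M = +-cancelˡ-≤ (4 * k) _ _ (begin
    4 * k + 7 * k              ≡⟨ *-distribʳ-+ k 4 7 ⟨
    11 * k                     ≤⟨ 11k≤2+n ⟩
    2 + n                      ≡⟨ cong (2 +_) n≡ ⟩
    2 + (c + # M + c)          ≡⟨ eq₁ c (# M) ⟩
    2 * (c + 1) + # M          ≡⟨ cong (λ t → 2 * t + # M) c+1 ⟩
    2 * (2 * k) + # M          ≡⟨ cong (_+ # M) (*-assoc 2 2 k) ⟨
    4 * k + # M                ∎)
    where
    open ≤-Reasoning
    eq₁ : ∀ c m → 2 + (c + m + c) ≡ 2 * (c + 1) + m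
    eq₁ = solve-∀

  k+1≤n : k + 1 ≤ n
  k+1≤n = +-cancelˡ-≤ 2 _ _ (begin
    2 + (k + 1)        ≡⟨ cong (2 +_) (+-comm k 1) ⟩
    3 + k              ≤⟨ +-monoˡ-≤ k (*-monoʳ-≤ 3 0<k) ⟩
    3 * k + k          ≤⟨ m≤m+n (3 * k + k) (7 * k) ⟩
    3 * k + k + 7 * k  ≡⟨ eq k ⟩
    11 * k             ≤⟨ 11k≤2+n ⟩
    2 + n              ∎)
    where
    open ≤-Reasoning
    eq : ∀ k → 3 * k + k + 7 * k ≡ 11 * k
    eq = solve-∀

  -- Since c = 2k - 1 is odd, half of it rounds up to k.
  halve : ∀ x y → y ≡ c → y ≤ 2 * x → k ≤ x
  halve x _ refl c≤2x = ≮⇒≥ λ x<k → <⇒≱ (+-cancelʳ-< 1 (2 * x) c (begin-strict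
    2 * x + 1        <⟨ n<1+n _ ⟩
    suc (2 * x + 1)  ≡⟨ eq x ⟩
    2 * suc x        ≤⟨ *-monoʳ-≤ 2 x<k ⟩
    2 * k            ≡⟨ c+1 ⟨
    c + 1            ∎)) c≤2x
    where
    open ≤-Reasoning
    eq : ∀ x → suc (2 * x + 1) ≡ 2 * suc x
    eq = solve-∀

  B-to-A : ∀ b → B b ≡ true → k ≤ # (A ∩ invertAll D sets b)
  B-to-A b b∈B = halve _ _ #A (≤-trans (columns b b∈B) (≤-reflexive (cong (2 *_) (sum-cong-≗ cell))))
    where
    cell : ∀ a → 𝟙 (A a ∧ switched (flip D) α β a b) ≡ 𝟙 (A a ∧ invertAll D sets b a)
    cell a with A a in a∈A
    ... | true  = cong 𝟙 (sym (from-B-to-A a b a∈A b∈B))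
    ... | false = refl
  A-from-B : ∀ a → A a ≡ true → k ≤ # (B ∩ flip (invertAll D sets) a)
  A-from-B a a∈A = halve _ _ #B (≤-trans (rows a a∈A) (≤-reflexive (cong (2 *_) (sum-cong-≗ cell))))
    where
    cell : ∀ b → 𝟙 (B b ∧ switched (flip D) α β a b) ≡ 𝟙 (B b ∧ invertAll D sets b a)
    cell b with B b in b∈B
    ... | true  = cong 𝟙 (sym (from-B-to-A a b a∈A b∈B))
    ... | false = refl

  strong : Strong k (invertAll D sets)
  strong = strong-if-no-separation k+1≤n λ P Q S sides #S<k no-arc →
    Separation.impossible {k = k} tournament A M B P Q S zones sides
      (trans (cong (_+ 1) #A) c+1) (trans (cong (_+ 1) #B) c+1) #S<k 7k≤#M A-maximal B-maximal
      same-at-M B-to-A A-from-B no-arc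

strong-by-two-inversions : ∀ {k} → 0 < k → 11 * k ∸ 2 ≤ n → (D : Digraph n) → IsTournament D →
  ∃[ Xs ] (length Xs ≡ 2 × Strong k (invertAll D Xs))
strong-by-two-inversions {n} {k} 0<k large D tournament =
  let Z , extremal = extremal-zones {c = c} D 2c≤n
      α , β , rows , columns = switching (flip D) (Zones.A Z) (Zones.B Z)
  in TwoInversions.sets D tournament Z α β , refl ,
     BalancedInversions.strong 0<k 11k≤2+n tournament c+1 Z extremal α β rows columns
  where
  11k≤2+n : 11 * k ≤ 2 + n
  11k≤2+n = ≤-trans (m≤n+m∸n (11 * k) 2) (+-monoʳ-≤ 2 large)
  c : ℕ
  c = 2 * k ∸ 1
  c+1 : c + 1 ≡ 2 * k
  c+1 = m∸n+n≡m (≤-trans 0<k (m≤m+n k (k + 0)))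
  2c≤n : 2 * c ≤ n
  2c≤n = +-cancelˡ-≤ 2 _ _ (begin
    2 + 2 * c     ≡⟨ eq c ⟩
    2 * (c + 1)   ≡⟨ cong (2 *_) c+1 ⟩
    2 * (2 * k)   ≡⟨ *-assoc 2 2 k ⟨
    4 * k         ≤⟨ *-monoˡ-≤ k (s≤s (s≤s (s≤s (s≤s (z≤n {7}))))) ⟩
    11 * k        ≤⟨ 11k≤2+n ⟩
    2 + n         ∎)
    where
    open ≤-Reasoning
    eq : ∀ c → 2 + 2 * c ≡ 2 * (c + 1)
    eq = solve-∀

-- Vertex and arc connectivity

∣∪∣≤ : (p q : Subset n) → ∣ p ∪ q ∣ ≤ ∣ p ∣ + ∣ q ∣
∣∪∣≤ []          []          = z≤n
∣∪∣≤ (true ∷ p)  (true ∷ q)  = s≤s (≤-trans (∣∪∣≤ p q) (+-monoʳ-≤ ∣ p ∣ (n≤1+n ∣ q ∣)))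
∣∪∣≤ (true ∷ p)  (false ∷ q) = s≤s (∣∪∣≤ p q)
∣∪∣≤ (false ∷ p) (true ∷ q)  = ≤-trans (s≤s (∣∪∣≤ p q)) (≤-reflexive (sym (+-suc ∣ p ∣ ∣ q ∣)))
∣∪∣≤ (false ∷ p) (false ∷ q) = ∣∪∣≤ p q

module _ (u : Fin n) where

  -- For an arc leaving a set that contains `u`, this end differs from `u`, so a set of such ends
  -- can be deleted without losing `u`.
  end : Fin n × Fin n → Fin n
  end (x , y) with x ≟ u
  ... | yes _ = y
  ... | no  _ = x

  cover : List (Fin n × Fin n) → Subset n
  cover []       = ∅
  cover (e ∷ es) = ⁅ end e ⁆ ∪ cover es

  ∣cover∣ : ∀ es → ∣ cover es ∣ ≤ length es
  ∣cover∣ []       = ≤-reflexive (∣⊥∣≡0 n)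
  ∣cover∣ (e ∷ es) = ≤-trans (∣∪∣≤ ⁅ end e ⁆ (cover es)) (+-mono-≤ (≤-reflexive (∣⁅x⁆∣≡1 (end e))) (∣cover∣ es))

  end∈cover : ∀ {e es} → e ∈ˡ es → end e ∈ cover es
  end∈cover (here refl) = x∈p∪q⁺ (inj₁ (x∈⁅x⁆ _))
  end∈cover (there e∈)  = x∈p∪q⁺ (inj₂ (end∈cover e∈))

  ∈cover⇒end : ∀ {z} es → z ∈ cover es → ∃[ e ] (e ∈ˡ es × z ≡ end e)
  ∈cover⇒end []       z∈ = contradiction z∈ ∉⊥
  ∈cover⇒end (e ∷ es) z∈ with x∈p∪q⁻ ⁅ end e ⁆ (cover es) z∈
  ... | inj₁ z∈e = e , here refl , x∈⁅y⁆⇒x≡y _ z∈e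
  ... | inj₂ z∈es with ∈cover⇒end es z∈es
  ...   | e′ , e′∈ , eq = e′ , there e′∈ , eq

  end-≡ : ∀ y → end (u , y) ≡ y
  end-≡ y with u ≟ u
  ... | yes _   = refl
  ... | no  u≢u = contradiction refl u≢u

  end-≢ : ∀ {x} y → x ≢ u → end (x , y) ≡ x
  end-≢ {x} y x≢u with x ≟ u
  ... | yes x≡u = contradiction x≡u x≢u
  ... | no  _   = refl

leaving? : ∀ {n} (D : Digraph n) (V₁ : Subset n) → Decidable (λ ((u , v) : Fin n × Fin n) → u ∈ V₁ × v ∈ ∁ V₁ × T (D u v))
leaving? D V₁ (u , v) = u ∈? V₁ ×-dec v ∈? ∁ V₁ ×-dec T? (D u v)

-- Suppose fewer than k arcs leave V₁, and fix u in V₁. Let S consist of the tails of these arcs,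
-- except that an arc leaving u contributes its head. If some u → v with v outside V₁ is missing then S separates
-- v from u; if V₁ dominates its complement then S contains all vertices but u, so it has at least k elements.
strong⇒arc-strong : ∀ {k} {D : Digraph n} → Strong k D → ArcStrong k D
strong⇒arc-strong {n} {k} {D} (k+1≤n , connected) V₁ (u₀ , u₀∈) (v₀ , v₀∈) = ≮⇒≥ few⇒⊥
  where
  L = arcsFromTo D V₁ (∁ V₁)

  ∈L : ∀ {x y} → x ∈ V₁ → y ∈ ∁ V₁ → T (D x y) → (x , y) ∈ˡ L
  ∈L x∈ y∈ xy = ∈-filter⁺ (leaving? D V₁) (∈-cartesianProduct⁺ (∈-allFin _) (∈-allFin _)) (x∈ , y∈ , xy)

  L∈ : ∀ {x y} → (x , y) ∈ˡ L → x ∈ V₁ × y ∈ ∁ V₁ × T (D x y)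
  L∈ e∈L = proj₂ (∈-filter⁻ (leaving? D V₁) {xs = cartesianProduct (allFin n) (allFin n)} e∈L)

  crossing : ∀ {S x y} → x ∈ V₁ → y ∉ V₁ → Star (ArcAvoiding D S) x y →
    ∃[ a ] ∃[ b ] (a ∈ V₁ × b ∈ ∁ V₁ × ArcAvoiding D S a b)
  crossing x∈ y∉ ε = contradiction x∈ y∉
  crossing x∈ y∉ (_◅_ {j = z} xz path) with z ∈? V₁
  ... | yes z∈ = crossing z∈ y∉ path
  ... | no  z∉ = _ , z , x∈ , x∉p⇒x∈∁p z∉ , xz

  few⇒⊥ : ¬ length L < k
  few⇒⊥ few with any? (λ u → any? λ v → u ∈? V₁ ×-dec v ∈? ∁ V₁ ×-dec ¬? (T? (D u v)))
  -- A path from u to v that avoids the cover would leave `V₁` by an arc of `L`, but one end of that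
  -- arc is in the cover.
  ... | yes (u , v , u∈ , v∈ , ¬uv) with crossing u∈ (x∈∁p⇒x∉p v∈) (connected (cover u L) (≤-<-trans (∣cover∣ u L) few) u v u∉ v∉)
    where
    u∉ : u ∉ cover u L
    u∉ u∈cover with ∈cover⇒end u L u∈cover
    ... | (x , y) , e∈L , eq with x ≟ u
    ...   | yes _   = contradiction u∈ (x∈∁p⇒x∉p (subst (_∈ ∁ V₁) (sym eq) (proj₁ (proj₂ (L∈ e∈L)))))
    ...   | no  x≢u = x≢u (sym eq)
    v∉ : v ∉ cover u L
    v∉ v∈cover with ∈cover⇒end u L v∈cover
    ... | (x , y) , e∈L , eq with x ≟ u
    ...   | yes refl = ¬uv (subst (T ∘ D u) (sym eq) (proj₂ (proj₂ (L∈ e∈L))))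
    ...   | no  _    = x∈∁p⇒x∉p v∈ (subst (_∈ V₁) (sym eq) (proj₁ (L∈ e∈L)))
  ...   | a , b , a∈ , b∈ , a∉S , b∉S , ab with a ≟ u
  ...     | yes refl = b∉S (subst (_∈ cover u L) (end-≡ u b) (end∈cover u (∈L a∈ b∈ ab)))
  ...     | no  a≢u  = a∉S (subst (_∈ cover u L) (end-≢ u b a≢u) (end∈cover u (∈L a∈ b∈ ab)))
  -- Here k + 1 ≤ n is used: the cover together with `u₀` is the whole vertex set, so n is at most
  -- the number of leaving arcs plus 1.
  few⇒⊥ few | no complete = <⇒≱ few (+-cancelʳ-≤ 1 k _ (≤-trans k+1≤n (≤-trans (≤-reflexive (sym (∣⊤∣≡n n)))
      (≤-trans (p⊆q⇒∣p∣≤∣q∣ {p = ⊤} {cover u₀ L ∪ ⁅ u₀ ⁆} λ {x} _ → everything x) (≤-trans (∣∪∣≤ (cover u₀ L) ⁅ u₀ ⁆)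
        (+-mono-≤ (∣cover∣ u₀ L) (≤-reflexive (∣⁅x⁆∣≡1 u₀))))))))
    where
    arc : ∀ {x y} → x ∈ V₁ → y ∈ ∁ V₁ → T (D x y)
    arc {x} {y} x∈ y∈ with T? (D x y)
    ... | yes xy = xy
    ... | no ¬xy = contradiction (x , y , x∈ , y∈ , ¬xy) complete
    everything : ∀ x → x ∈ cover u₀ L ∪ ⁅ u₀ ⁆
    everything x with x ≟ u₀
    ... | yes refl = x∈p∪q⁺ (inj₂ (x∈⁅x⁆ x))
    ... | no  x≢u₀ with x ∈? V₁
    ...   | yes x∈ = x∈p∪q⁺ (inj₁ (subst (_∈ cover u₀ L) (end-≢ u₀ v₀ x≢u₀) (end∈cover u₀ (∈L x∈ v₀∈ (arc x∈ v₀∈)))))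
    ...   | no  x∉ = x∈p∪q⁺ (inj₁ (subst (_∈ cover u₀ L) (end-≡ u₀ x)
                       (end∈cover u₀ (∈L u₀∈ (x∉p⇒x∈∁p x∉) (arc u₀∈ (x∉p⇒x∈∁p x∉))))))

-- Extrema of decidable predicates on ℕ

least : {P : ℕ → Set} → Decidable P → ∀ m → P m → ∃[ s ] IsMin P s
least P? zero    p = zero , p , λ _ _ → z≤n
least P? (suc m) p with P? zero
... | yes p₀ = zero , p₀ , λ _ _ → z≤n
... | no ¬p₀ with least (P? ∘ suc) m p
...   | s , ps , minimal = suc s , ps , λ where
        zero    p₀ → contradiction p₀ ¬p₀
        (suc j) pj → s≤s (minimal j pj)

greatest : {P : ℕ → Set} → Decidable P → ∀ b → (∀ j → P j → j ≤ b) → ∃[ j ] P j → ∃[ m ] IsMax P m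
greatest P? zero    bounded (j , pj) with z≤n ← bounded j pj = zero , pj , bounded
greatest P? (suc b) bounded some with P? (suc b)
... | yes p = suc b , p , bounded
... | no ¬p = greatest P? b (λ j pj → ≤-pred (≤∧≢⇒< (bounded j pj) λ { refl → ¬p pj })) some

-- Descending from `b`, the search stops at `L` or just above the first index where `P` fails, so
-- only finitely many values of `P` are tested.
least-threshold : {P : ℕ → Set} → Decidable P → ∀ L b → L ≤ b → (∀ n → b ≤ n → P n) →
  ∃[ N ] IsMin (λ N → L ≤ N × (∀ n → N ≤ n → P n)) N
least-threshold {P} P? L zero L≤b from-b = zero , (L≤b , from-b) , λ _ _ → z≤n
least-threshold {P} P? L (suc b) L≤1+b from-1+b with L ≤? b | P? b
... | yes L≤b | yes pb = least-threshold P? L b L≤b from-b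
  where
  from-b : ∀ n → b ≤ n → P n
  from-b n b≤n with m≤n⇒m<n∨m≡n b≤n
  ... | inj₁ b<n  = from-1+b n b<n
  ... | inj₂ refl = pb
... | yes _   | no ¬pb = suc b , (L≤1+b , from-1+b) , λ N (_ , from-N) → ≰⇒> λ N≤b → ¬pb (from-N b N≤b)
... | no L≰b  | _ = suc b , (L≤1+b , from-1+b) , λ N (L≤N , _) → ≤-trans (≰⇒> L≰b) L≤N

-- Digraphs up to pointwise equality

infix 4 _≐_
_≐_ : Digraph n → Digraph n → Set
D ≐ D′ = ∀ u v → D u v ≡ D′ u v

≐-sym : {D D′ : Digraph n} → D ≐ D′ → D′ ≐ D
≐-sym D≐D′ u v = sym (D≐D′ u v)

invert-≐ : {D D′ : Digraph n} (X : Subset n) → D ≐ D′ → invert D X ≐ invert D′ X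
invert-≐ X D≐D′ u v with lookup X u ∧ lookup X v
... | true  = D≐D′ v u
... | false = D≐D′ u v

invertAll-≐ : {D D′ : Digraph n} (Xs : List (Subset n)) → D ≐ D′ → invertAll D Xs ≐ invertAll D′ Xs
invertAll-≐ []       D≐D′ = D≐D′
invertAll-≐ (X ∷ Xs) D≐D′ = invertAll-≐ Xs (invert-≐ X D≐D′)

invert-tournament : {D : Digraph n} (X : Subset n) → IsTournament D → IsTournament (invert D X)
invert-tournament {D = D} X t = record { loopless = loopless′ ; oriented = oriented′ }
  where
  open IsTournament t
  loopless′ : ∀ u → invert D X u u ≡ false
  loopless′ u with lookup X u ∧ lookup X u
  ... | true  = loopless u
  ... | false = loopless u
  oriented′ : ∀ {u v} → u ≢ v → invert D X u v ≡ not (invert D X v u)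
  oriented′ {u} {v} u≢v rewrite ∧-comm (lookup X v) (lookup X u) with lookup X u ∧ lookup X v
  ... | true  = oriented (u≢v ∘ sym)
  ... | false = oriented u≢v

invertAll-tournament : {D : Digraph n} (Xs : List (Subset n)) → IsTournament D → IsTournament (invertAll D Xs)
invertAll-tournament []       t = t
invertAll-tournament (X ∷ Xs) t = invertAll-tournament Xs (invert-tournament X t)

tournament-≐ : {D D′ : Digraph n} → D ≐ D′ → IsTournament D → IsTournament D′
tournament-≐ D≐D′ t = record
  { loopless = λ u → trans (sym (D≐D′ u u)) (loopless u)
  ; oriented = λ {u} {v} u≢v → trans (sym (D≐D′ u v)) (trans (oriented u≢v) (cong not (D≐D′ v u)))
  }
  where open IsTournament t

tournament? : (D : Digraph n) → Dec (IsTournament D)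
tournament? D = map′
  (λ (l , o) → record { loopless = l ; oriented = λ {u} {v} → o u v })
  (λ t → IsTournament.loopless t , λ u v → IsTournament.oriented t)
  (all? (λ u → D u u ≟ᵇ false) ×-dec all? λ u → all? λ v → ¬? (u ≟ v) →-dec (D u v ≟ᵇ not (D v u)))

-- Ensures that a maximum over all tournaments of order n is not taken over the empty set.
transitive-tournament : ∀ n → ∃[ D ] IsTournament {n} D
transitive-tournament n = D , record { loopless = λ u → dec-false (toℕ u <? toℕ u) (<-irrefl refl) ; oriented = oriented }
  where
  D : Digraph n
  D u v = does (toℕ u <? toℕ v)
  oriented : ∀ {u v} → u ≢ v → D u v ≡ not (D v u)
  oriented {u} {v} u≢v with <-cmp (toℕ u) (toℕ v)
  ... | tri< u<v _ v≮u = trans (dec-true (toℕ u <? toℕ v) u<v) (cong not (sym (dec-false (toℕ v <? toℕ u) v≮u)))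
  ... | tri≈ _ u≡v _   = contradiction (toℕ-injective u≡v) u≢v
  ... | tri> u≮v _ v<u = trans (dec-false (toℕ u <? toℕ v) u≮v) (cong not (sym (dec-true (toℕ v <? toℕ u) v<u)))

any-rows? : ∀ m {P : Vec (Subset n) m → Set} → Decidable P → Dec (∃[ rows ] P rows)
any-rows? zero    P? = map′ (λ p → [] , p) (λ { ([] , p) → p }) (P? [])
any-rows? (suc m) P? = map′ (λ (X , rows , p) → X ∷ rows , p) (λ { (X ∷ rows , p) → X , rows , p })
  (anySubset? λ X → any-rows? m (P? ∘ (X ∷_)))

-- Digraphs are enumerated through their adjacency rows. The digraph rebuilt from rows is compared
-- with the original pointwise, which is why `P` must respect `≐`.
any-digraph? : {P : Digraph n → Set} → (∀ {D D′} → D ≐ D′ → P D → P D′) → Decidable P → Dec (∃[ D ] P D)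
any-digraph? {n} {P} P-≐ P? = map′ (λ (rows , p) → digraph rows , p) encode (any-rows? n (P? ∘ digraph))
  where
  digraph : Vec (Subset n) n → Digraph n
  digraph rows u v = lookup (lookup rows u) v
  encode : ∃[ D ] P D → ∃[ rows ] P (digraph rows)
  encode (D , p) = tabulate (λ u → tabulate (D u)) , P-≐ (λ u v → sym (trans
    (cong (λ row → lookup row v) (lookup∘tabulate (λ u → tabulate (D u)) u)) (lookup∘tabulate (D u) v))) p

-- Inverting {u, v} reverses exactly the arc between u and v, so the disagreements of two
-- tournaments can be repaired one pair at a time.
invert-pair : {D E : Digraph n} → IsTournament D → IsTournament E → ∀ u v → D u v ≢ E u v →
  ∀ x y → (x , y) ≡ (u , v) ⊎ D x y ≡ E x y → invert D (⁅ u ⁆ ∪ ⁅ v ⁆) x y ≡ E x y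
invert-pair {D = D} {E} d e u v D≢E x y reason with lookup X x in x∈ | lookup X y in y∈
  where X = ⁅ u ⁆ ∪ ⁅ v ⁆
... | true | true = both (member x∈) (member y∈)
  where
  open IsTournament
  X = ⁅ u ⁆ ∪ ⁅ v ⁆
  member : ∀ {z} → lookup X z ≡ true → z ≡ u ⊎ z ≡ v
  member {z} z∈ with x∈p∪q⁻ ⁅ u ⁆ ⁅ v ⁆ (lookup⇒[]= z X z∈)
  ... | inj₁ z∈u = inj₁ (x∈⁅y⁆⇒x≡y u z∈u)
  ... | inj₂ z∈v = inj₂ (x∈⁅y⁆⇒x≡y v z∈v)
  u≢v : u ≢ v
  u≢v refl = D≢E (trans (loopless d u) (sym (loopless e u)))
  Dvu : D v u ≡ E u v
  Dvu = trans (oriented d (u≢v ∘ sym)) (sym (¬-not (D≢E ∘ sym)))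
  both : x ≡ u ⊎ x ≡ v → y ≡ u ⊎ y ≡ v → D y x ≡ E x y
  both (inj₁ refl) (inj₁ refl) = trans (loopless d u) (sym (loopless e u))
  both (inj₁ refl) (inj₂ refl) = Dvu
  both (inj₂ refl) (inj₁ refl) = trans (oriented d u≢v) (trans (cong not Dvu) (sym (oriented e (u≢v ∘ sym))))
  both (inj₂ refl) (inj₂ refl) = trans (loopless d v) (sym (loopless e v))
... | true | false = outside reason
  where
  outside : (x , y) ≡ (u , v) ⊎ D x y ≡ E x y → D x y ≡ E x y
  outside (inj₂ eq) = eq
  outside (inj₁ refl) with () ← trans (sym y∈) ([]=⇒lookup (x∈p∪q⁺ {p = ⁅ u ⁆} (inj₂ (x∈⁅x⁆ v))))
... | false | _ = outside reason
  where
  outside : (x , y) ≡ (u , v) ⊎ D x y ≡ E x y → D x y ≡ E x y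
  outside (inj₂ eq) = eq
  outside (inj₁ refl) with () ← trans (sym x∈) ([]=⇒lookup (x∈p∪q⁺ {q = ⁅ v ⁆} (inj₁ (x∈⁅x⁆ u))))

transform : {D E : Digraph n} → IsTournament D → IsTournament E → ∃[ Xs ] invertAll D Xs ≐ E
transform {n} {E = E} d e with repair (cartesianProduct (allFin n) (allFin n)) d
  where
  -- Invariant: every pair that is still listed or already agrees will agree in the end. Inverting
  -- {u, v} corrects (u, v) and (v, u) and disturbs no other pair.
  repair : ∀ (pairs : List (Fin n × Fin n)) {D} → IsTournament D →
    ∃[ Xs ] (∀ x y → (x , y) ∈ˡ pairs ⊎ D x y ≡ E x y → invertAll D Xs x y ≡ E x y)
  repair [] d = [] , λ { x y (inj₂ eq) → eq }
  repair ((u , v) ∷ pairs) {D} d with D u v ≟ᵇ E u v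
  ... | yes agree = map₂ (λ fixed x y → λ where
          (inj₁ (here refl)) → fixed x y (inj₂ agree)
          (inj₁ (there x∈))  → fixed x y (inj₁ x∈)
          (inj₂ eq)          → fixed x y (inj₂ eq)) (repair pairs d)
  ... | no disagree with repair pairs (invert-tournament (⁅ u ⁆ ∪ ⁅ v ⁆) d)
  ...   | Xs , fixed = (⁅ u ⁆ ∪ ⁅ v ⁆) ∷ Xs , λ where
          x y (inj₁ (here eq))  → fixed x y (inj₂ (invert-pair d e u v disagree x y (inj₁ eq)))
          x y (inj₁ (there x∈)) → fixed x y (inj₁ x∈)
          x y (inj₂ eq)         → fixed x y (inj₂ (invert-pair d e u v disagree x y (inj₂ eq)))
... | Xs , fixed = Xs , λ u v → fixed u v (inj₁ (∈-cartesianProduct⁺ (∈-allFin u) (∈-allFin v)))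

-- Decidability and existence of the extremal parameters

all-subsets? : {P : Subset n → Set} → Decidable P → Dec (∀ S → P S)
all-subsets? P? = map′ (λ none S → decidable-stable (P? S) λ ¬p → none (S , ¬p)) (λ all (S , ¬p) → ¬p (all S))
  (¬? (anySubset? (¬? ∘ P?)))

strong? : ∀ k (D : Digraph n) → Dec (Strong k D)
strong? {n} k D = (k + 1 ≤? n) ×-dec all-subsets? λ S → (∣ S ∣ <? k) →-dec
  all? λ u → all? λ v → ¬? (u ∈? S) →-dec (¬? (v ∈? S) →-dec path? S u v)
  where
  path? : ∀ S u v → Dec (Star (ArcAvoiding D S) u v)
  path? S u v with reachable-set (arc-avoiding? D S) u
  ... | P , closed = map′ (ReachableSet.reachable P v)
    (closed-under-Star (ReachableSet.set P) closed (ReachableSet.source P)) (ReachableSet.set P v ≟ᵇ true)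

arc-strong? : ∀ k (D : Digraph n) → Dec (ArcStrong k D)
arc-strong? k D = all-subsets? λ V₁ → nonempty? V₁ →-dec (nonempty? (∁ V₁) →-dec (k ≤? length (arcsFromTo D V₁ (∁ V₁))))

strong-≐ : {D D′ : Digraph n} → D ≐ D′ → Strong k D → Strong k D′
strong-≐ D≐D′ (k+1≤n , connected) = k+1≤n , λ S ∣S∣<k u v u∉S v∉S →
  Star.map (λ {x} {y} (x∉S , y∉S , xy) → x∉S , y∉S , subst T (D≐D′ x y) xy) (connected S ∣S∣<k u v u∉S v∉S)

arc-strong-≐ : {D D′ : Digraph n} → D ≐ D′ → ArcStrong k D → ArcStrong k D′
arc-strong-≐ {n} {k} {D} {D′} D≐D′ strong V₁ ne ne′ = subst (k ≤_) (cong length same) (strong V₁ ne ne′)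
  where
  same : arcsFromTo D V₁ (∁ V₁) ≡ arcsFromTo D′ V₁ (∁ V₁)
  same = filter-≐ (leaving? D V₁) (leaving? D′ V₁) ((λ {(u , v)} (u∈ , v∈ , uv) → u∈ , v∈ , subst T (D≐D′ u v) uv) ,
                       (λ {(u , v)} (u∈ , v∈ , uv) → u∈ , v∈ , subst T (sym (D≐D′ u v)) uv))
                      (cartesianProduct (allFin n) (allFin n))

module Thresholds (Q : ConnectivityNotion) (k : ℕ) (Q? : ∀ {n} (D : Digraph n) → Dec (Q k D))
  (Q-≐ : ∀ {n} {D D′ : Digraph n} → D ≐ D′ → Q k D → Q k D′) where

  Invertible : Digraph n → ℕ → Set
  Invertible {n} D s = ∃[ Xs ] (length {A = Subset n} Xs ≡ s × Q k (invertAll D Xs))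

  invertible? : (D : Digraph n) → Decidable (Invertible D)
  invertible? D zero    = map′ (λ q → [] , refl , q) (λ { ([] , _ , q) → q }) (Q? D)
  invertible? D (suc s) = map′
    (λ (X , Xs , len , q) → X ∷ Xs , cong suc len , q)
    (λ { (X ∷ Xs , len , q) → X , Xs , suc-injective len , q })
    (anySubset? λ X → invertible? (invert D X) s)

  invertible-≐ : {D D′ : Digraph n} → D ≐ D′ → ∀ {s} → Invertible D s → Invertible D′ s
  invertible-≐ D≐D′ (Xs , len , q) = Xs , len , Q-≐ (invertAll-≐ Xs D≐D′) q

  -- Minimality is equivalent to failure for every j < s, a finite check.
  inversion-number? : (D : Digraph n) → Decidable (IsInversionNumber Q k D)
  inversion-number? D s = invertible? D s ×-dec map′
    (λ (below : ∀ {j} → j < s → ¬ Invertible D j) j inv → ≮⇒≥ λ j<s → below j<s inv)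
    (λ minimal j<s inv → <⇒≱ j<s (minimal _ inv))
    (allUpTo? (¬? ∘ invertible? D) s)

  inversion-number-≐ : {D D′ : Digraph n} → D ≐ D′ → ∀ {s} → IsInversionNumber Q k D s → IsInversionNumber Q k D′ s
  inversion-number-≐ D≐D′ (inv , minimal) = invertible-≐ D≐D′ inv , λ j inv′ → minimal j (invertible-≐ (≐-sym D≐D′) inv′)

  Within : ℕ → Digraph n → Set
  Within i D = ∃[ s ] (s < suc i × Invertible D s)

  AllWithin : ℕ → ℕ → Set
  AllWithin i n = (D : Digraph n) → IsTournament D → Within i D

  inversion-number : ∀ {i} {D : Digraph n} → Within i D → ∃[ s ] (IsInversionNumber Q k D s × s ≤ i)
  inversion-number {D = D} (s , s≤i , inv) with least (invertible? D) s inv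
  ... | s₀ , min@(_ , minimal) = s₀ , min , ≤-trans (minimal s inv) (≤-pred s≤i)

  -- Decided by searching the finitely many digraphs of order n for a counterexample.
  all-within? : ∀ i n → Dec (AllWithin i n)
  all-within? i n = map′
    (λ none D t → decidable-stable (within? D) λ ¬within → none (D , t , ¬within))
    (λ all (D , t , ¬within) → ¬within (all D t))
    (¬? (any-digraph? {n} {λ D → IsTournament D × ¬ Within i D}
      (λ D≐D′ (t , ¬within) → tournament-≐ D≐D′ t , λ (s , s≤i , inv) → ¬within (s , s≤i , invertible-≐ (≐-sym D≐D′) inv))
      λ D → tournament? D ×-dec ¬? (within? D)))
    where
    within? : (D : Digraph n) → Dec (Within i D)
    within? D = anyUpTo? (invertible? D) (suc i)

  BoundedMax : ℕ → ℕ → Set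
  BoundedMax i n = ∃[ m ] (IsMaxInversionNumber Q k n m × m ≤ i)

  all-within⇒bounded-max : ∀ {i n} → AllWithin i n → BoundedMax i n
  all-within⇒bounded-max {i} {n} all = m , max , bounded m (proj₁ max)
    where
    P : ℕ → Set
    P s = ∃[ D ] (IsTournament {n} D × IsInversionNumber Q k D s)
    P? : Decidable P
    P? s = any-digraph? (λ D≐D′ (t , num) → tournament-≐ D≐D′ t , inversion-number-≐ D≐D′ num)
      λ D → tournament? D ×-dec inversion-number? D s
    bounded : ∀ j → P j → j ≤ i
    bounded j (D , t , _ , minimal) = let s , s≤i , inv = all D t in ≤-trans (minimal s inv) (≤-pred s≤i)
    some : ∃[ s ] P s
    some = let D , t = transitive-tournament n ; s , num , _ = inversion-number (all D t) in s , D , t , num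
    result : ∃[ m ] IsMax P m
    result = greatest P? i bounded some
    m = proj₁ result
    max = proj₂ result

  -- The maximum is attained, so some tournament of order n has property Q,
  -- and every other tournament can be transformed into it.
  bounded-max⇒all-within : ∀ {i n} → BoundedMax i n → AllWithin i n
  bounded-max⇒all-within (m , ((E , e , (Xs , _ , q) , _) , maximal) , m≤i) D t
    with transform t (invertAll-tournament Xs e)
  ... | Ys , D≐E with least (invertible? D) (length Ys) (Ys , refl , Q-≐ (≐-sym D≐E) q)
  ...   | s , num@(inv , _) = s , s≤s (≤-trans (maximal s (D , t , num)) m≤i) , inv

  -- The condition on the maximum is decided through the equivalent condition `AllWithin`, as
  -- required for the descent in `least-threshold`.
  threshold : ∀ {i b} → 2 * k + 1 ≤ b → (∀ n → b ≤ n → AllWithin i n) → ∃[ N ] IsThreshold Q k i N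
  threshold {i} {b} 2k+1≤b all = least-threshold
    (λ n → map′ all-within⇒bounded-max bounded-max⇒all-within (all-within? i n))
    (2 * k + 1) b 2k+1≤b λ n b≤n → all-within⇒bounded-max (all n b≤n)

theorem1p14 : (k : ℕ) → 0 < k →
    (∃[ N′ ] ∃[ N ] (IsN′ k 3 N′ × IsN k 3 N × N′ ≤ N × N ≤ 11 * k ∸ 2))
    × (∀ n → 11 * k ∸ 2 ≤ n → (D : Digraph n) → IsTournament D →
    ∃[ s′ ] ∃[ s ] (IsSinv′ k D s′ × IsSinv k D s × s′ ≤ s × s ≤ 3))
theorem1p14 k 0<k = thresholds , numbers
  where
  module V = Thresholds Strong k (strong? k) strong-≐
  module A = Thresholds ArcStrong k (arc-strong? k) arc-strong-≐

  b = 11 * k ∸ 2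

  strong⇒arc : ∀ {n s} {D : Digraph n} → V.Invertible D s → A.Invertible D s
  strong⇒arc (Xs , len , strong) = Xs , len , strong⇒arc-strong strong

  V-all : ∀ n → b ≤ n → V.AllWithin 3 n
  V-all n b≤n D t = let Xs , len , strong = strong-by-two-inversions 0<k b≤n D t in
    2 , s≤s (s≤s (s≤s z≤n)) , Xs , len , strong

  V⇒A : ∀ {n} → V.AllWithin 3 n → A.AllWithin 3 n
  V⇒A all D t = let s , s≤3 , inv = all D t in s , s≤3 , strong⇒arc inv

  2k+1≤b : 2 * k + 1 ≤ b
  2k+1≤b = m+n≤o⇒m≤o∸n (2 * k + 1) (begin
    2 * k + 1 + 2     ≡⟨ +-assoc (2 * k) 1 2 ⟩
    2 * k + 3         ≤⟨ +-monoʳ-≤ (2 * k) (*-monoʳ-≤ 3 0<k) ⟩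
    2 * k + 3 * k     ≤⟨ m≤m+n (2 * k + 3 * k) (6 * k) ⟩
    2 * k + 3 * k + 6 * k ≡⟨ eq k ⟩
    11 * k            ∎)
    where
    open ≤-Reasoning
    eq : ∀ k → 2 * k + 3 * k + 6 * k ≡ 11 * k
    eq = solve-∀

  thresholds : ∃[ N′ ] ∃[ N ] (IsN′ k 3 N′ × IsN k 3 N × N′ ≤ N × N ≤ b)
  thresholds =
    let N  , isN@((2k+1≤N , from-N) , N-minimal) = V.threshold 2k+1≤b V-all
        N′ , isN′@(_ , N′-minimal) = A.threshold 2k+1≤b λ n b≤n → V⇒A (V-all n b≤n)
    in N′ , N , isN′ , isN
     -- `N` satisfies the condition that defines `N′`: beyond it all tournaments are within 3
     -- inversions of a k-strong one, hence of a k-arc-strong one.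
     , N′-minimal N (2k+1≤N , λ n N≤n → A.all-within⇒bounded-max (V⇒A (V.bounded-max⇒all-within (from-N n N≤n))))
     , N-minimal b (2k+1≤b , λ n b≤n → V.all-within⇒bounded-max (V-all n b≤n))

  numbers : ∀ n → b ≤ n → (D : Digraph n) → IsTournament D →
    ∃[ s′ ] ∃[ s ] (IsSinv′ k D s′ × IsSinv k D s × s′ ≤ s × s ≤ 3)
  numbers n b≤n D t =
    let s  , sinv@(inv , _) , s≤3 = V.inversion-number (V-all n b≤n D t)
        s′ , sinv′@(_ , minimal) , _ = A.inversion-number (V⇒A (V-all n b≤n) D t)
    in s′ , s , sinv′ , sinv , minimal s (strong⇒arc inv) , s≤3
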